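{- Let $m\ge 1$ and $b\in[-1,1]^m$, and let $q^*$ and $q_*$ be the supervertex and the subvertex of $P(b)$. For any $u\in (U_{\ell\text{ -pos}})^+$ we have $\langle u,q_*\rangle\ge 0$ and $$\max\{E_x(u): x\in P(b)\}=E_{q^*}(u)=\langle u,q^*\rangle,$$ $$\min\{E_x(u): x\in P(b)\}\ \ge\ \langle u,q_*\rangle .$$ If $\sum_{i=1}^m b(i)\le 2-m$, then $q_*\in P(b)$, the last inequality is an equality, and $\langle u,q_*\rangle=E_{q_*}(u)$.
   Context: Fix an integer $m\ge1$. $\mathcal L$ is the set of all functions $\lambda:\{1,\dots,m\}\to\{0,1\}$, with the convention $\lambda(0)=0$. $\mathbb R^{\mathcal L}$ is the space of functions $\mathcal L\to\mathbb R$ with standard basis $\{e_\lambda\}$ and standard inner product $\langle x,y\rangle=\sum_\lambda x(\lambda)y(\lambda)$. For $0\le i\le m$ let $\ell_i\in\mathbb R^{\mathcal L}$, $\ell_i(\lambda)=(-1)^{\lambda(i)}$ (so $\ell_0$ is constant $1$). For $b\in\mathbb R^m$, $P(b)=\{x\in\mathbb R^{\mathcal L}: x(\lambda)\ge 0 \text{ for all }\lambda,\ \langle \ell_0,x\rangle=1,\ \langle \ell_i,x\rangle=b(i)\text{ for }1\le i\le m\}$; its elements are probability density functions on $\mathcal L$. For such $x$ and $f\in\mathbb R^{\mathcal L}$, $E_x(f)=\langle f,x\rangle$ is the expectation. Truncation: for $t\in\mathbb R$, $t^+=\max\{t,0\}$; for $v\in\mathbb R^{\mathcal L}$, $v^+(\lambda)=v(\lambda)^+$.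 $U_{\ell\text{ -pos}}$ is the set of vectors $\sum_{i=0}^m a_i\ell_i$ with $a_1,\dots,a_m>0$ and $a_0\in\mathbb R$ arbitrary. $(U_{\ell\text{ -pos}})^+=\{\sum_{i=1}^k u_i^+ : u_i\in U_{\ell\text{ -pos}},\ k\ge 0\}$. Supervertex $q^*$ (for $b\in[-1,1]^m$): put $b(0)=1$, $b(m+1)=-1$. If $b(1)\ge\dots\ge b(m)$, set $b'(i)=\frac{b(i)-b(i+1)}2$ for $0\le i\le m$, let $\mu_i\in\mathcal L$ be $\mu_i(k)=0$ if $k\le i$ and $\mu_i(k)=1$ if $k\ge i+1$, and let $q^*=\sum_{i=0}^m b'(i)e_{\mu_i}$. For general $b$, choose a permutation $\sigma$ of $\{1,\dots,m\}$ with $b\circ\sigma^{ -1}$ decreasing; $q^*$ is the vector for which $\lambda\mapsto q^*(\lambda\circ\sigma)$ is the supervertex of $P(b\circ\sigma^{ -1})$ (this does not depend on the choice of $\sigma$). Subvertex $q_*$ (for $b\in[-1,1]^m$): $\nu_i\in\mathcal L$, $0\le i\le m$, is $\nu_i(j)=1-\delta_{ij}$ for $1\le j\le m$; $b''(i)=\frac{b(i)+1}{2}$ for $1\le i\le m$, $b''(0)=1-\sum_{i=1}^m b''(i)$; and $q_*=\sum_{i=0}^m b''(i)e_{\nu_i}\in\mathbb R^{\mathcal L}$ (in general $q_*$ need not lie in $P(b)$). -}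

module Defs where

open import Algebra.Bundles using (CommutativeRing)
import Algebra.Construct.NaturalChoice.Max as NaturalMax
import Algebra.Definitions.RawMonoid as RawMonoidOps
import Algebra.Properties.Monoid.Sum as MonoidSum
open import Data.Bool using (Bool; true; false; if_then_else_; not)
import Data.Bool.Properties as Bool
open import Data.Fin as Fin using (Fin; zero; suc; fromℕ; punchIn)
open import Data.Fin.Permutation as Perm using (Permutation′; _⟨$⟩ʳ_; _⟨$⟩ˡ_)
open import Data.Nat as ℕ using (ℕ; zero; suc; s≤s)
open import Data.Product using (∃; ∃-syntax; Σ-syntax; _×_; _,_)
open import Data.Sum using (inj₁; inj₂)
open import Data.Vec using (Vec; []; _∷_; lookup; tabulate)
import Data.Vec.Functional as Vector
open Vector using (Vector; insertAt)
open import Data.Vec.Properties using (≡-dec; lookup∘tabulate; tabulate∘lookup; tabulate-cong)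
open import Level using (Level; _⊔_) renaming (suc to lsuc)
open import Relation.Binary.Bundles using (DecTotalOrder)
open import Relation.Binary.Core using (Rel)
open import Relation.Binary.PropositionalEquality as ≡ using (_≡_)
open import Relation.Binary.Structures using (IsDecTotalOrder)
open import Relation.Nullary using (¬_; does)
open import Relation.Unary using (Pred; _∈_)

-- ℝ is taken as an arbitrary Dedekind-complete linearly ordered field, which
-- classically determines it up to isomorphism.  The order is decidable, as
-- trichotomy is a law of the classical reals.  The inverse is total; its value
-- at 0 is unspecified.
record Reals (c ℓ₁ ℓ₂ : Level) : Set (lsuc (c ⊔ ℓ₁ ⊔ ℓ₂)) where
  infix 4 _≤_ _<_
  infix 8 _⁻¹

  field
    commutativeRing : CommutativeRing c ℓ₁

  open CommutativeRing commutativeRing public hiding (zero)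

  field
    _⁻¹             : Carrier → Carrier
    _≤_             : Rel Carrier ℓ₂
    0≉1             : ¬ (0# ≈ 1#)
    *-inverseʳ      : ∀ x → ¬ (x ≈ 0#) → x * x ⁻¹ ≈ 1#
    isDecTotalOrder : IsDecTotalOrder _≈_ _≤_
    +-monoʳ-≤       : ∀ x {y z} → y ≤ z → x + y ≤ x + z
    *-nonNegative   : ∀ {x y} → 0# ≤ x → 0# ≤ y → 0# ≤ x * y

  IsUpperBound : Pred Carrier (c ⊔ ℓ₁ ⊔ ℓ₂) → Pred Carrier (c ⊔ ℓ₁ ⊔ ℓ₂)
  IsUpperBound S s = ∀ x → x ∈ S → x ≤ s

  field
    complete : ∀ (S : Pred Carrier (c ⊔ ℓ₁ ⊔ ℓ₂)) → ∃ S → ∃ (IsUpperBound S) →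
               ∃[ s ] IsUpperBound S s × (∀ t → IsUpperBound S t → s ≤ t)

  _<_ : Rel Carrier (ℓ₁ ⊔ ℓ₂)
  x < y = x ≤ y × ¬ (x ≈ y)

  decTotalOrder : DecTotalOrder c ℓ₁ ℓ₂
  decTotalOrder = record { isDecTotalOrder = isDecTotalOrder }

-- Functions {1,…,m} → {0,1}, stored as vectors so that equality is extensional
-- and decidable; false is 0 and true is 1.  The index i ∈ {1,…,m} is the
-- position i - 1 : Fin m, while i ∈ {0,…,m} is i : Fin (suc m).  Hence an index
-- j : Fin m is suc j when seen in {0,…,m}.
𝓛 : ℕ → Set
𝓛 m = Vec Bool m

infix 9 _₍_₎
infixl 8 _∘𝓛_

-- Evaluation on {0,…,m}, with the convention l(0) = 0.
_₍_₎ : ∀ {m} → 𝓛 m → Fin (suc m) → Bool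
l ₍ i ₎ = lookup (false ∷ l) i

_∘𝓛_ : ∀ {m} → 𝓛 m → (Fin m → Fin m) → 𝓛 m
l ∘𝓛 f = tabulate (λ k → lookup l (f k))

module Densities {c ℓ₁ ℓ₂} (ℝ : Reals c ℓ₁ ℓ₂) where

  open Reals ℝ
  open DecTotalOrder decTotalOrder using (totalOrder)
    renaming (refl to ≤-refl; trans to ≤-trans; total to ≤-total)
  open NaturalMax totalOrder public using () renaming (_⊔_ to max)
  open MonoidSum +-monoid public using (sum; sum-syntax; sum⁺-syntax)
  open RawMonoidOps +-rawMonoid using () renaming (_×_ to _·_)

  infixl 7 _/_
  _/_ : Carrier → Carrier → Carrier
  x / y = x * y ⁻¹

  2# : Carrier
  2# = 1# + 1#

  fromNat : ℕ → Carrier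
  fromNat n = n · 1#

  ℝ^𝓛 : ℕ → Set c
  ℝ^𝓛 m = 𝓛 m → Carrier

  ∑𝓛 : ∀ {m} → ℝ^𝓛 m → Carrier
  ∑𝓛 {zero}  f = f []
  ∑𝓛 {suc m} f = ∑𝓛 (λ l → f (false ∷ l)) + ∑𝓛 (λ l → f (true ∷ l))

  ⟨_,_⟩ : ∀ {m} → ℝ^𝓛 m → ℝ^𝓛 m → Carrier
  ⟨ x , y ⟩ = ∑𝓛 (λ l → x l * y l)

  e : ∀ {m} → 𝓛 m → ℝ^𝓛 m
  e l l′ = if does (≡-dec Bool._≟_ l l′) then 1# else 0#

  [-1]^_ : Bool → Carrier
  [-1]^ false = 1#
  [-1]^ true  = - 1#

  ℓ : ∀ {m} → Fin (suc m) → ℝ^𝓛 m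
  ℓ i l = [-1]^ (l ₍ i ₎)

  P : ∀ {m} → Vector Carrier m → Pred (ℝ^𝓛 m) (ℓ₁ ⊔ ℓ₂)
  P b x = (∀ l → 0# ≤ x l)
        × ⟨ ℓ zero , x ⟩ ≈ 1#
        × (∀ i → ⟨ ℓ (suc i) , x ⟩ ≈ b i)

  E : ∀ {m} → ℝ^𝓛 m → ℝ^𝓛 m → Carrier
  E x f = ⟨ f , x ⟩

  E-values : ∀ {m} → Vector Carrier m → ℝ^𝓛 m → Pred Carrier (c ⊔ ℓ₁ ⊔ ℓ₂)
  E-values b u v = ∃[ x ] x ∈ P b × v ≈ E x u

  IsMaximum IsMinimum : ∀ {p} → Pred Carrier p → Pred Carrier (c ⊔ ℓ₂ ⊔ p)
  IsMaximum S v = v ∈ S × (∀ w → w ∈ S → w ≤ v)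
  IsMinimum S v = v ∈ S × (∀ w → w ∈ S → v ≤ w)

  _⁺ : ∀ {m} → ℝ^𝓛 m → ℝ^𝓛 m
  (v ⁺) l = max (v l) 0#

  Uℓ-pos : ∀ {m} → Pred (ℝ^𝓛 m) (c ⊔ ℓ₁ ⊔ ℓ₂)
  Uℓ-pos {m} u = Σ[ a ∈ Vector Carrier (suc m) ]
                 (∀ (i : Fin m) → 0# < a (suc i))
                 × (∀ l → u l ≈ ∑[ i ≤ m ] (a i * ℓ i l))

  Uℓ-pos⁺ : ∀ {m} → Pred (ℝ^𝓛 m) (c ⊔ ℓ₁ ⊔ ℓ₂)
  Uℓ-pos⁺ {m} u = Σ[ k ∈ ℕ ] Σ[ us ∈ Vector (ℝ^𝓛 m) k ]
                  (∀ j → us j ∈ Uℓ-pos)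
                  × (∀ l → u l ≈ ∑[ j < k ] ((us j ⁺) l))

  InUnitCube : ∀ {m} → Vector Carrier m → Set ℓ₂
  InUnitCube b = ∀ i → - 1# ≤ b i × b i ≤ 1#

  Decreasing : ∀ {m} → Vector Carrier m → Set ℓ₂
  Decreasing b = ∀ {i j} → i Fin.≤ j → b j ≤ b i

  -- The two sequences are b(0),…,b(m) and b(1),…,b(m+1).
  b′ : ∀ {m} → Vector Carrier m → Vector Carrier (suc m)
  b′ {m} b i = ((1# Vector.∷ b) i - insertAt b (fromℕ m) (- 1#) i) / 2#

  μ : ∀ {m} → Fin (suc m) → 𝓛 m
  μ i = tabulate (λ k → does (i Fin.<? suc k))

  sortedSupervertex : ∀ {m} → Vector Carrier m → ℝ^𝓛 m
  sortedSupervertex {m} b l = ∑[ i ≤ m ] (b′ b i * e (μ i) l)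

  _∘⁻¹_ : ∀ {m} → Vector Carrier m → Permutation′ m → Vector Carrier m
  (b ∘⁻¹ σ) i = b (σ ⟨$⟩ˡ i)

  -- Stated as a relation so that every admissible choice of σ is covered.
  IsSupervertex : ∀ {m} → Vector Carrier m → Pred (ℝ^𝓛 m) (ℓ₁ ⊔ ℓ₂)
  IsSupervertex b q =
    ∃[ σ ] Decreasing (b ∘⁻¹ σ)
         × (∀ l → q (l ∘𝓛 (σ ⟨$⟩ʳ_)) ≈ sortedSupervertex (b ∘⁻¹ σ) l)

  ν : ∀ {m} → Fin (suc m) → 𝓛 m
  ν i = tabulate (λ j → not (does (i Fin.≟ suc j)))

  b″ : ∀ {m} → Vector Carrier m → Vector Carrier (suc m)
  b″ {m} b zero    = 1# - ∑[ i < m ] ((b i + 1#) / 2#)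
  b″ {m} b (suc i) = (b i + 1#) / 2#

  subvertex : ∀ {m} → Vector Carrier m → ℝ^𝓛 m
  subvertex {m} b l = ∑[ i ≤ m ] (b″ b i * e (ν i) l)

  private
    argmax : ∀ {m} (b : Vector Carrier (suc m)) → ∃[ i ] (∀ j → b j ≤ b i)
    argmax {zero}  b = zero , λ { zero → ≤-refl }
    argmax {suc m} b with argmax (Vector.tail b)
    ... | i , i-max with ≤-total (b zero) (b (suc i))
    ...   | inj₁ b₀≤bᵢ = suc i , λ { zero → b₀≤bᵢ ; (suc j) → i-max j }
    ...   | inj₂ bᵢ≤b₀ = zero  , λ { zero → ≤-refl ; (suc j) → ≤-trans (i-max j) bᵢ≤b₀ }

    sorting : ∀ {m} (b : Vector Carrier m) → ∃[ σ ] Decreasing (b ∘⁻¹ σ)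
    sorting {zero}  b = Perm.id , λ { {()} }
    sorting {suc m} b with argmax b
    ... | i , i-max with sorting (λ j → b (punchIn i j))
    ...   | σ , σ-sorts = Perm.insert i zero σ , λ
      { {zero}  {zero}  _         → ≤-refl
      ; {zero}  {suc k} _         → i-max _
      ; {suc j} {suc k} (s≤s j≤k) → σ-sorts j≤k
      }

    ∘𝓛-cancel : ∀ {m} (σ : Permutation′ m) (l : 𝓛 m) →
                (l ∘𝓛 (σ ⟨$⟩ʳ_)) ∘𝓛 (σ ⟨$⟩ˡ_) ≡ l
    ∘𝓛-cancel σ l = ≡.trans
      (tabulate-cong λ k → ≡.trans (lookup∘tabulate _ (σ ⟨$⟩ˡ k))
                                   (≡.cong (lookup l) (Perm.inverseʳ σ)))
      (tabulate∘lookup l)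

  supervertex-exists : ∀ {m} (b : Vector Carrier m) → ∃ (IsSupervertex b)
  supervertex-exists b with sorting b
  ... | σ , σ-sorts =
    (λ l → sortedSupervertex (b ∘⁻¹ σ) (l ∘𝓛 (σ ⟨$⟩ˡ_))) , σ , σ-sorts ,
    λ l → reflexive (≡.cong (sortedSupervertex (b ∘⁻¹ σ)) (∘𝓛-cancel σ l))

{-# OPTIONS --safe #-}
-- A truncated u ∈ U_ℓ-pos is the convex function t ↦ t⁺ applied to an affine
-- functional of the indicators of λ(i) = 0, with nonnegative slopes.  Increments
-- of a convex function grow with the base point.  Hence the affine functional
-- that telescopes u⁺ along the chain μ_0, …, μ_m majorizes u⁺ with equality on
-- the support of q*, and the one that interpolates u⁺ at ν_0, …, ν_m minorizes
-- it; all of P(b) agrees on the expectation of an affine functional.  That the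
-- minimum is attained follows from Fourier–Motzkin elimination: the v that are
-- at least E_x(u) for some x ∈ P(b) are cut out by finitely many linear
-- inequalities.

module Submission where

open import Algebra.Bundles using (CommutativeRing; RawRing)
import Algebra.Construct.NaturalChoice.Max as NaturalMax
import Algebra.Properties.AbelianGroup as AbelianGroupProperties
import Algebra.Properties.CommutativeSemigroup as CommutativeSemigroupProperties
import Algebra.Properties.Ring as RingProperties
import Algebra.Properties.Semiring.Mult.TCOptimised as Multiples
import Algebra.Properties.Semiring.Sum as SemiringSum
import Algebra.Solver.Ring as RingSolver
open import Algebra.Solver.Ring.AlmostCommutativeRing
  using (fromCommutativeRing; _-Raw-AlmostCommutative⟶_)
open import Defs
open import Data.Bool using (true; false; if_then_else_)
import Data.Bool.Properties as Bool
open import Data.Fin as Fin using (Fin; zero; suc; fromℕ)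
open import Data.Fin.Permutation as Perm using (Permutation′; _⟨$⟩ʳ_; _⟨$⟩ˡ_)
open import Data.List as List using (List; []; _∷_; _++_)
open import Data.List.Relation.Unary.All as All using (All; []; _∷_)
import Data.List.Relation.Unary.All.Properties as All
open import Data.Maybe using (Maybe; just; nothing)
open import Data.Nat as ℕ using (ℕ; zero; suc; z≤n; s≤s) renaming (_≤_ to _≤ℕ_)
open import Data.Product using (∃-syntax; Σ-syntax; _×_; _,_; proj₁; proj₂)
open import Data.Sum using (_⊎_; inj₁; inj₂)
open import Data.Vec using ([]; _∷_; lookup)
open import Data.Vec.Functional as Vector using (Vector; insertAt)
open import Data.Vec.Properties using (≡-dec; lookup∘tabulate; tabulate∘lookup; tabulate-cong)
open import Function using (_∘_; _⇔_; mk⇔; Equivalence)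
open import Level using (_⊔_) renaming (suc to lsuc)
open import Relation.Binary.Bundles using (DecTotalOrder)
open import Relation.Binary.PropositionalEquality as ≡ using (_≡_)
import Relation.Binary.Reasoning.Setoid as SetoidReasoning
open import Relation.Nullary using (¬_; does; yes; no; contradiction)
open import Relation.Nullary.Decidable using (does-⇔)
open import Relation.Unary using (Pred; _∈_)

-- The weight of `subvertex b` at `ν zero` can be negative; the subvertex then lies outside P(b),
-- and no formula for a minimizer is at hand. That the minimum exists therefore needs an argument
-- that produces no explicit minimizer, and elimination is one that works by arithmetic and order
-- comparisons alone. The negative weight does not spoil the lower bound: truncation is compared
-- with an affine functional only at members of P(b), and for that functional just the total mass
-- and the moments of the subvertex matter. Indicators of λ(i) = 0 are preferred to the ℓ_i because
-- the chain and the star then share a base point, the constant function 1, where all indicators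
-- vanish. Each step of the chain turns on one more indicator, and each ray of the star turns on
-- exactly one.

-- A formal difference p - n of naturals is a coefficient whose equality is
-- decided by computation, which lets the solver cancel in an abstract ring.
module DifferenceSolver {c ℓ} (R : CommutativeRing c ℓ) where
  open CommutativeRing R hiding (zero)
  open Multiples semiring using () renaming (_×_ to _·_; ×-homo-+ to ·-homo-+; 1+× to 1+·; ×1-homo-* to ·1-homo-*)
  open RingProperties ring using ([y-z]x≈yx-zx; x[y-z]≈xy-xz)
  open AbelianGroupProperties +-abelianGroup using (⁻¹-∙-comm; ⁻¹-anti-homo‿-; ε⁻¹≈ε)
  open CommutativeSemigroupProperties +-commutativeSemigroup using (interchange)
  open SetoidReasoning setoid

  -- Normal forms are compared by refl, so equal coefficients must be identical.
  reduce : ℕ → ℕ → ℕ × ℕ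
  reduce (suc p) (suc n) = reduce p n
  reduce p       n       = p , n

  differences : RawRing _ _
  differences = record
    { Carrier = ℕ × ℕ
    ; _≈_     = _≡_
    ; _+_     = λ (p , n) (q , k) → reduce (p ℕ.+ q) (n ℕ.+ k)
    ; _*_     = λ (p , n) (q , k) → reduce (p ℕ.* q ℕ.+ n ℕ.* k) (p ℕ.* k ℕ.+ n ℕ.* q)
    ; -_      = λ (p , n) → n , p
    ; 0#      = 0 , 0
    ; 1#      = 1 , 0
    }

  -- The case n = 0 makes the constants 0, 1 and 2 evaluate to 0#, 1# and
  -- 1# + 1# on the nose.
  ⟦_⟧ : ℕ × ℕ → Carrier
  ⟦ p , zero  ⟧ = p · 1#
  ⟦ p , suc n ⟧ = p · 1# - suc n · 1#

  ⟦⟧≈- : ∀ p n → ⟦ p , n ⟧ ≈ p · 1# - n · 1#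
  ⟦⟧≈- p zero    = sym (trans (+-congˡ ε⁻¹≈ε) (+-identityʳ _))
  ⟦⟧≈- p (suc n) = refl

  -‿+-interchange : ∀ w x y z → (w + x) - (y + z) ≈ (w - y) + (x - z)
  -‿+-interchange w x y z =
    trans (+-congˡ (sym (⁻¹-∙-comm y z))) (interchange w x (- y) (- z))

  -‿cancel : ∀ x y z → (x + z) - (y + z) ≈ x - y
  -‿cancel x y z = begin
    (x + z) - (y + z)    ≈⟨ -‿+-interchange x z y z ⟩
    (x - y) + (z - z)    ≈⟨ +-congˡ (-‿inverseʳ z) ⟩
    (x - y) + 0#         ≈⟨ +-identityʳ _ ⟩
    x - y                ∎

  ⟦reduce⟧ : ∀ p n → ⟦ reduce p n ⟧ ≈ p · 1# - n · 1#
  ⟦reduce⟧ zero    n       = ⟦⟧≈- zero n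
  ⟦reduce⟧ (suc p) zero    = ⟦⟧≈- (suc p) zero
  ⟦reduce⟧ (suc p) (suc n) = begin
    ⟦ reduce p n ⟧                     ≈⟨ ⟦reduce⟧ p n ⟩
    p · 1# - n · 1#                    ≈⟨ -‿cancel _ _ _ ⟨
    (p · 1# + 1#) - (n · 1# + 1#)      ≈⟨ +-cong (suc-· p) (-‿cong (suc-· n)) ⟩
    suc p · 1# - suc n · 1#            ∎
    where
    suc-· : ∀ k → k · 1# + 1# ≈ suc k · 1#
    suc-· k = trans (+-comm _ _) (sym (1+· k 1#))

  ⟦⟧-+-homo : ∀ x y → ⟦ RawRing._+_ differences x y ⟧ ≈ ⟦ x ⟧ + ⟦ y ⟧
  ⟦⟧-+-homo (p , n) (q , k) = begin
    ⟦ reduce (p ℕ.+ q) (n ℕ.+ k) ⟧             ≈⟨ ⟦reduce⟧ (p ℕ.+ q) (n ℕ.+ k) ⟩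
    (p ℕ.+ q) · 1# - (n ℕ.+ k) · 1#            ≈⟨ +-cong (·-homo-+ 1# p q) (-‿cong (·-homo-+ 1# n k)) ⟩
    (p · 1# + q · 1#) - (n · 1# + k · 1#)      ≈⟨ -‿+-interchange _ _ _ _ ⟩
    (p · 1# - n · 1#) + (q · 1# - k · 1#)      ≈⟨ +-cong (⟦⟧≈- p n) (⟦⟧≈- q k) ⟨
    ⟦ p , n ⟧ + ⟦ q , k ⟧                      ∎

  ⟦⟧-*-homo : ∀ x y → ⟦ RawRing._*_ differences x y ⟧ ≈ ⟦ x ⟧ * ⟦ y ⟧
  ⟦⟧-*-homo (p , n) (q , k) = begin
    ⟦ reduce (p ℕ.* q ℕ.+ n ℕ.* k) (p ℕ.* k ℕ.+ n ℕ.* q) ⟧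
      ≈⟨ ⟦reduce⟧ (p ℕ.* q ℕ.+ n ℕ.* k) (p ℕ.* k ℕ.+ n ℕ.* q) ⟩
    (p ℕ.* q ℕ.+ n ℕ.* k) · 1# - (p ℕ.* k ℕ.+ n ℕ.* q) · 1#
      ≈⟨ +-cong (expand p q n k) (-‿cong (expand p k n q)) ⟩
    (P * Q + N * K) - (P * K + N * Q)
      ≈⟨ -‿+-interchange _ _ _ _ ⟩
    (P * Q - P * K) + (N * K - N * Q)
      ≈⟨ +-congˡ (⁻¹-anti-homo‿- _ _) ⟨
    (P * Q - P * K) - (N * Q - N * K)
      ≈⟨ +-cong (x[y-z]≈xy-xz P Q K) (-‿cong (x[y-z]≈xy-xz N Q K)) ⟨
    P * (Q - K) - N * (Q - K)
      ≈⟨ [y-z]x≈yx-zx (Q - K) P N ⟨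
    (P - N) * (Q - K)
      ≈⟨ *-cong (⟦⟧≈- p n) (⟦⟧≈- q k) ⟨
    ⟦ p , n ⟧ * ⟦ q , k ⟧ ∎
    where
    P = p · 1#
    N = n · 1#
    Q = q · 1#
    K = k · 1#
    expand : ∀ a b c d → (a ℕ.* b ℕ.+ c ℕ.* d) · 1# ≈ a · 1# * b · 1# + c · 1# * d · 1#
    expand a b c d = trans (·-homo-+ 1# (a ℕ.* b) (c ℕ.* d))
                           (+-cong (·1-homo-* a b) (·1-homo-* c d))

  ⟦⟧-neg-homo : ∀ x → ⟦ RawRing.-_ differences x ⟧ ≈ - ⟦ x ⟧
  ⟦⟧-neg-homo (p , n) = begin
    ⟦ n , p ⟧               ≈⟨ ⟦⟧≈- n p ⟩
    n · 1# - p · 1#         ≈⟨ ⁻¹-anti-homo‿- _ _ ⟨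
    - (p · 1# - n · 1#)     ≈⟨ -‿cong (⟦⟧≈- p n) ⟨
    - ⟦ p , n ⟧             ∎

  homomorphism : differences -Raw-AlmostCommutative⟶ fromCommutativeRing R
  homomorphism = record
    { ⟦_⟧    = ⟦_⟧
    ; +-homo = ⟦⟧-+-homo
    ; *-homo = ⟦⟧-*-homo
    ; -‿homo = ⟦⟧-neg-homo
    ; 0-homo = refl
    ; 1-homo = refl
    }

  -- Agreement of the cross sums is proved sound only; `nothing` asserts no inequality, so the
  -- characteristic of the ring does not matter.
  decide : ∀ x y → Maybe (⟦ x ⟧ ≈ ⟦ y ⟧)
  decide (p , n) (q , k) with p ℕ.+ k ℕ.≟ q ℕ.+ n
  ... | no  _  = nothing
  ... | yes eq = just (begin
    ⟦ p , n ⟧                                  ≈⟨ ⟦⟧≈- p n ⟩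
    p · 1# - n · 1#                            ≈⟨ -‿cancel _ _ _ ⟨
    (p · 1# + k · 1#) - (n · 1# + k · 1#)      ≈⟨ +-cong same (-‿cong (+-comm _ _)) ⟩
    (q · 1# + n · 1#) - (k · 1# + n · 1#)      ≈⟨ -‿cancel _ _ _ ⟩
    q · 1# - k · 1#                            ≈⟨ ⟦⟧≈- q k ⟨
    ⟦ q , k ⟧                                  ∎)
    where
    same : p · 1# + k · 1# ≈ q · 1# + n · 1#
    same = trans (sym (·-homo-+ 1# p k))
                 (trans (reflexive (≡.cong (_· 1#) eq)) (·-homo-+ 1# q n))

  open RingSolver differences (fromCommutativeRing R) homomorphism decide public
    using (solve; _:=_; _:+_; _:*_; _:-_; :-_; con; Polynomial)

  :0 :1 :2 : ∀ {n} → Polynomial n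
  :0 = con (0 , 0)
  :1 = con (1 , 0)
  :2 = con (2 , 0)

module _ {c ℓ₁ ℓ₂} (ℝ : Reals c ℓ₁ ℓ₂) where

  open Reals ℝ
  open Densities ℝ
  open DifferenceSolver commutativeRing
    using (solve; _:=_; _:+_; _:*_; _:-_; :-_; :0; :1; :2)
  open DecTotalOrder decTotalOrder using (totalOrder; _≟_; ≤-respʳ-≈; ≤-respˡ-≈)
    renaming (refl to ≤-refl; reflexive to ≤-reflexive; trans to ≤-trans; total to ≤-total; antisym to ≤-antisym)
  open NaturalMax totalOrder
    using (⊔-sel; ⊔-cong; ⊔-monoˡ-≤) renaming (x≤x⊔y to x≤max; x≤y⊔x to y≤max)
  open SetoidReasoning setoid

  -- Ordered field arithmetic

  x≤y⇒0≤y-x : ∀ {x y} → x ≤ y → 0# ≤ y - x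
  x≤y⇒0≤y-x {x} {y} x≤y = ≤-respˡ-≈ (-‿inverseˡ x) (≤-respʳ-≈ (+-comm _ _) (+-monoʳ-≤ (- x) x≤y))

  0≤d⇒x≤x+d : ∀ {x y d} → 0# ≤ d → y ≈ x + d → x ≤ y
  0≤d⇒x≤x+d {x} 0≤d y≈x+d =
    ≤-respˡ-≈ (+-identityʳ x) (≤-respʳ-≈ (sym y≈x+d) (+-monoʳ-≤ x 0≤d))

  0≤y-x⇒x≤y : ∀ {x y} → 0# ≤ y - x → x ≤ y
  0≤y-x⇒x≤y {x} {y} 0≤y-x =
    0≤d⇒x≤x+d 0≤y-x (solve 2 (λ x y → y := x :+ (y :- x)) refl x y)

  +-mono-≤ : ∀ {w x y z} → w ≤ x → y ≤ z → w + y ≤ x + z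
  +-mono-≤ {w} {x} {y} {z} w≤x y≤z =
    ≤-trans (+-monoʳ-≤ w y≤z) (≤-respˡ-≈ (+-comm z w) (≤-respʳ-≈ (+-comm z x) (+-monoʳ-≤ z w≤x)))

  +-nonNegative : ∀ {x y} → 0# ≤ x → 0# ≤ y → 0# ≤ x + y
  +-nonNegative 0≤x 0≤y = ≤-respˡ-≈ (+-identityˡ 0#) (+-mono-≤ 0≤x 0≤y)

  *-monoˡ-≤ : ∀ {x y z} → 0# ≤ x → y ≤ z → x * y ≤ x * z
  *-monoˡ-≤ {x} {y} {z} 0≤x y≤z =
    0≤d⇒x≤x+d (*-nonNegative 0≤x (x≤y⇒0≤y-x y≤z))
              (solve 3 (λ x y z → x :* z := x :* y :+ x :* (z :- y)) refl x y z)

  x≤0⇒0≤-x : ∀ {x} → x ≤ 0# → 0# ≤ - x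
  x≤0⇒0≤-x x≤0 = ≤-respʳ-≈ (+-identityˡ _) (x≤y⇒0≤y-x x≤0)

  0≤-x⇒x≤0 : ∀ {x} → 0# ≤ - x → x ≤ 0#
  0≤-x⇒x≤0 0≤-x = 0≤y-x⇒x≤y (≤-respʳ-≈ (sym (+-identityˡ _)) 0≤-x)

  0≤1 : 0# ≤ 1#
  0≤1 with ≤-total 0# 1#
  ... | inj₁ 0≤1 = 0≤1
  ... | inj₂ 1≤0 =
    ≤-respʳ-≈ (solve 0 ((:- :1) :* (:- :1) := :1) refl)
              (*-nonNegative (x≤0⇒0≤-x 1≤0) (x≤0⇒0≤-x 1≤0))

  0<x⇒x≉0 : ∀ {x} → 0# < x → ¬ (x ≈ 0#)
  0<x⇒x≉0 (_ , 0≉x) x≈0 = 0≉x (sym x≈0)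

  *-inverseˡ : ∀ {x} → 0# < x → x ⁻¹ * x ≈ 1#
  *-inverseˡ 0<x = trans (*-comm _ _) (*-inverseʳ _ (0<x⇒x≉0 0<x))

  0≤x⁻¹ : ∀ {x} → 0# < x → 0# ≤ x ⁻¹
  0≤x⁻¹ {x} 0<x with ≤-total 0# (x ⁻¹)
  ... | inj₁ 0≤x⁻¹ = 0≤x⁻¹
  ... | inj₂ x⁻¹≤0 = contradiction (≤-antisym 0≤1 1≤0) 0≉1
    where
    1≤0 : 1# ≤ 0#
    1≤0 = ≤-respˡ-≈ (*-inverseʳ x (0<x⇒x≉0 0<x))
            (≤-respʳ-≈ (zeroʳ x) (*-monoˡ-≤ (proj₁ 0<x) x⁻¹≤0))

  *-cancel-nonNegative : ∀ {x y} → 0# < x → 0# ≤ x * y → 0# ≤ y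
  *-cancel-nonNegative {x} {y} 0<x 0≤xy = ≤-respʳ-≈ x⁻¹xy≈y (*-nonNegative (0≤x⁻¹ 0<x) 0≤xy)
    where
    x⁻¹xy≈y : x ⁻¹ * (x * y) ≈ y
    x⁻¹xy≈y = trans (sym (*-assoc _ _ _)) (trans (*-congʳ (*-inverseˡ 0<x)) (*-identityˡ y))

  0<2 : 0# < 2#
  0<2 = +-nonNegative 0≤1 0≤1 , λ 0≈2 →
    0≉1 (≤-antisym 0≤1 (≤-respʳ-≈ (sym 0≈2) (0≤d⇒x≤x+d 0≤1 refl)))

  -- The negative case speaks of `- x` so that `isolate` divides by a positive number in both
  -- nonzero cases.
  trichotomy : ∀ x → 0# < x ⊎ x ≈ 0# ⊎ 0# < - x
  trichotomy x with ≤-total 0# x | x ≟ 0#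
  ... | _        | yes x≈0 = inj₂ (inj₁ x≈0)
  ... | inj₁ 0≤x | no  x≉0 = inj₁ (0≤x , x≉0 ∘ sym)
  ... | inj₂ x≤0 | no  x≉0 = inj₂ (inj₂ (x≤0⇒0≤-x x≤0 , λ 0≈-x →
    x≉0 (trans (solve 1 (λ x → x := :0 :- (:- x)) refl x) (trans (+-congˡ (-‿cong (sym 0≈-x))) (-‿inverseʳ 0#)))))

  -- Truncation

  pos : Carrier → Carrier
  pos x = max x 0#

  pos-cong : ∀ {x y} → x ≈ y → pos x ≈ pos y
  pos-cong x≈y = ⊔-cong x≈y refl

  x≤pos : ∀ x → x ≤ pos x
  x≤pos x = x≤max x 0#

  0≤pos : ∀ x → 0# ≤ pos x
  0≤pos x = y≤max x 0#

  pos-mono-≤ : ∀ {x y} → x ≤ y → pos x ≤ pos y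
  pos-mono-≤ = ⊔-monoˡ-≤ 0#

  -- Convexity: the increment of a convex function over a step a ≥ 0 grows
  -- with the base point.
  pos-increment-mono : ∀ {x y a} → x ≤ y → 0# ≤ a → pos (x + a) - pos x ≤ pos (y + a) - pos y
  pos-increment-mono {x} {y} {a} x≤y 0≤a with ⊔-sel (x + a) 0# | ⊔-sel y 0#
  -- If `pos (x + a)` is 0, then 0 separates the two increments. If `x + a` and `y` are their own
  -- truncations, then `a` separates them. In the remaining case `pos y` is 0, so the right
  -- increment is all of `pos (y + a)`.
  ... | inj₂ eq | _ = ≤-trans
    (0≤d⇒x≤x+d (0≤pos x)
      (sym (trans (+-congʳ (+-congʳ eq)) (solve 1 (λ p → :0 :- p :+ p := :0) refl (pos x)))))
    (x≤y⇒0≤y-x (pos-mono-≤ (0≤d⇒x≤x+d 0≤a refl)))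
  ... | inj₁ eq | inj₁ eq′ =
    0≤d⇒x≤x+d (+-nonNegative (x≤y⇒0≤y-x (x≤pos (y + a))) (x≤y⇒0≤y-x (x≤pos x)))
      (begin
        pos (y + a) - pos y
          ≈⟨ +-congˡ (-‿cong eq′) ⟩
        pos (y + a) - y
          ≈⟨ solve 5 (λ x y a p q → q :- y := (x :+ a :- p) :+ ((q :- (y :+ a)) :+ (p :- x)))
               refl x y a (pos x) (pos (y + a)) ⟩
        (x + a - pos x) + ((pos (y + a) - (y + a)) + (pos x - x))
          ≈⟨ +-congʳ (+-congʳ eq) ⟨
        (pos (x + a) - pos x) + ((pos (y + a) - (y + a)) + (pos x - x)) ∎)
  ... | inj₁ eq | inj₂ eq′ =
    0≤d⇒x≤x+d (+-nonNegative (x≤y⇒0≤y-x (pos-mono-≤ x+a≤y+a)) (0≤pos x))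
      (trans (+-congˡ (-‿cong eq′))
        (solve 3 (λ p q r → r :- :0 := (q :- p) :+ ((r :- q) :+ p)) refl (pos x) (pos (x + a)) (pos (y + a))))
    where
    x+a≤y+a : x + a ≤ y + a
    x+a≤y+a = +-mono-≤ x≤y ≤-refl

  -- Finite sums

  open SemiringSum semiring
    using (sum-cong-≋; ∑-distrib-+; *-distribˡ-sum; *-distribʳ-sum; sum-permute; sum-replicate)

  sum-nonNegative : ∀ {n} {f : Vector Carrier n} → (∀ i → 0# ≤ f i) → 0# ≤ sum f
  sum-nonNegative {zero}  0≤f = ≤-refl
  sum-nonNegative {suc n} 0≤f = +-nonNegative (0≤f zero) (sum-nonNegative (0≤f ∘ suc))

  sum-mono-≤ : ∀ {n} {f g : Vector Carrier n} → (∀ i → f i ≤ g i) → sum f ≤ sum g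
  sum-mono-≤ {zero}  f≤g = ≤-refl
  sum-mono-≤ {suc n} f≤g = +-mono-≤ (f≤g zero) (sum-mono-≤ (f≤g ∘ suc))

  sum-zero : ∀ {n} {f : Vector Carrier n} → (∀ i → f i ≈ 0#) → sum f ≈ 0#
  sum-zero {zero}  f≈0 = refl
  sum-zero {suc n} f≈0 = trans (+-cong (f≈0 zero) (sum-zero (f≈0 ∘ suc))) (+-identityˡ 0#)

  ∑𝓛-cong : ∀ {m} {f g : ℝ^𝓛 m} → (∀ l → f l ≈ g l) → ∑𝓛 f ≈ ∑𝓛 g
  ∑𝓛-cong {zero}  f≈g = f≈g []
  ∑𝓛-cong {suc m} f≈g = +-cong (∑𝓛-cong (f≈g ∘ (false ∷_))) (∑𝓛-cong (f≈g ∘ (true ∷_)))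

  ∑𝓛-mono-≤ : ∀ {m} {f g : ℝ^𝓛 m} → (∀ l → f l ≤ g l) → ∑𝓛 f ≤ ∑𝓛 g
  ∑𝓛-mono-≤ {zero}  f≤g = f≤g []
  ∑𝓛-mono-≤ {suc m} f≤g = +-mono-≤ (∑𝓛-mono-≤ (f≤g ∘ (false ∷_))) (∑𝓛-mono-≤ (f≤g ∘ (true ∷_)))

  ∑𝓛-zero : ∀ {m} {f : ℝ^𝓛 m} → (∀ l → f l ≈ 0#) → ∑𝓛 f ≈ 0#
  ∑𝓛-zero {zero}  f≈0 = f≈0 []
  ∑𝓛-zero {suc m} f≈0 =
    trans (+-cong (∑𝓛-zero (f≈0 ∘ (false ∷_))) (∑𝓛-zero (f≈0 ∘ (true ∷_)))) (+-identityˡ 0#)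

  ∑𝓛-distrib-+ : ∀ {m} (f g : ℝ^𝓛 m) → ∑𝓛 (λ l → f l + g l) ≈ ∑𝓛 f + ∑𝓛 g
  ∑𝓛-distrib-+ {zero}  f g = refl
  ∑𝓛-distrib-+ {suc m} f g =
    trans (+-cong (∑𝓛-distrib-+ (f ∘ (false ∷_)) (g ∘ (false ∷_))) (∑𝓛-distrib-+ (f ∘ (true ∷_)) (g ∘ (true ∷_))))
          (solve 4 (λ w x y z → (w :+ x) :+ (y :+ z) := (w :+ y) :+ (x :+ z)) refl _ _ _ _)

  *-distribˡ-∑𝓛 : ∀ {m} p (f : ℝ^𝓛 m) → p * ∑𝓛 f ≈ ∑𝓛 (λ l → p * f l)
  *-distribˡ-∑𝓛 {zero}  p f = refl
  *-distribˡ-∑𝓛 {suc m} p f =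
    trans (distribˡ p _ _) (+-cong (*-distribˡ-∑𝓛 p (f ∘ (false ∷_))) (*-distribˡ-∑𝓛 p (f ∘ (true ∷_))))

  ⟨⟩-congˡ : ∀ {m} {f g : ℝ^𝓛 m} x → (∀ l → f l ≈ g l) → ⟨ f , x ⟩ ≈ ⟨ g , x ⟩
  ⟨⟩-congˡ x f≈g = ∑𝓛-cong (λ l → *-congʳ (f≈g l))

  ⟨⟩-distribˡ-+ : ∀ {m} (f g x : ℝ^𝓛 m) → ⟨ (λ l → f l + g l) , x ⟩ ≈ ⟨ f , x ⟩ + ⟨ g , x ⟩
  ⟨⟩-distribˡ-+ {m} f g x = trans (∑𝓛-cong (λ l → distribʳ (x l) (f l) (g l))) (∑𝓛-distrib-+ {m} _ _)

  ⟨⟩-distribʳ-+ : ∀ {m} (f x y : ℝ^𝓛 m) → ⟨ f , (λ l → x l + y l) ⟩ ≈ ⟨ f , x ⟩ + ⟨ f , y ⟩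
  ⟨⟩-distribʳ-+ {m} f x y = trans (∑𝓛-cong (λ l → distribˡ (f l) (x l) (y l))) (∑𝓛-distrib-+ {m} _ _)

  ⟨⟩-*ˡ : ∀ {m} p (f x : ℝ^𝓛 m) → ⟨ (λ l → p * f l) , x ⟩ ≈ p * ⟨ f , x ⟩
  ⟨⟩-*ˡ {m} p f x = trans (∑𝓛-cong (λ l → *-assoc p (f l) (x l))) (sym (*-distribˡ-∑𝓛 {m} p _))

  ⟨⟩-*ʳ : ∀ {m} p (f x : ℝ^𝓛 m) → ⟨ f , (λ l → p * x l) ⟩ ≈ p * ⟨ f , x ⟩
  ⟨⟩-*ʳ {m} p f x =
    trans (∑𝓛-cong (λ l → solve 3 (λ p f x → f :* (p :* x) := p :* (f :* x)) refl p (f l) (x l)))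
          (sym (*-distribˡ-∑𝓛 {m} p _))

  ⟨⟩-sumˡ : ∀ {m n} (f : Fin n → ℝ^𝓛 m) (x : ℝ^𝓛 m) →
            ⟨ (λ l → ∑[ j < n ] f j l) , x ⟩ ≈ ∑[ j < n ] ⟨ f j , x ⟩
  ⟨⟩-sumˡ {n = zero}  f x = ∑𝓛-zero (λ l → zeroˡ (x l))
  ⟨⟩-sumˡ {n = suc n} f x = trans (⟨⟩-distribˡ-+ (f zero) _ x) (+-congˡ (⟨⟩-sumˡ (f ∘ suc) x))

  ⟨⟩-sumʳ : ∀ {m n} (f : ℝ^𝓛 m) (x : Fin n → ℝ^𝓛 m) →
            ⟨ f , (λ l → ∑[ j < n ] x j l) ⟩ ≈ ∑[ j < n ] ⟨ f , x j ⟩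
  ⟨⟩-sumʳ {n = zero}  f x = ∑𝓛-zero (λ l → zeroʳ (f l))
  ⟨⟩-sumʳ {n = suc n} f x = trans (⟨⟩-distribʳ-+ f (x zero) _) (+-congˡ (⟨⟩-sumʳ f (x ∘ suc)))

  ⟨⟩-comm : ∀ {m} (x y : ℝ^𝓛 m) → ⟨ x , y ⟩ ≈ ⟨ y , x ⟩
  ⟨⟩-comm x y = ∑𝓛-cong (λ l → *-comm (x l) (y l))

  ⟨⟩-monoˡ-≤ : ∀ {m} {f g : ℝ^𝓛 m} x → (∀ l → 0# ≤ x l) → (∀ l → f l ≤ g l) → ⟨ f , x ⟩ ≤ ⟨ g , x ⟩
  ⟨⟩-monoˡ-≤ x 0≤x f≤g = ∑𝓛-mono-≤ λ l →
    ≤-respˡ-≈ (*-comm _ _) (≤-respʳ-≈ (*-comm _ _) (*-monoˡ-≤ (0≤x l) (f≤g l)))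

  ⟨⟩-nonNegative : ∀ {m} {f x : ℝ^𝓛 m} → (∀ l → 0# ≤ f l) → (∀ l → 0# ≤ x l) → 0# ≤ ⟨ f , x ⟩
  ⟨⟩-nonNegative {f = f} {x} 0≤f 0≤x =
    ≤-respˡ-≈ (∑𝓛-zero (λ l → zeroˡ (x l))) (⟨⟩-monoˡ-≤ x 0≤x 0≤f)

  ⟨f,e⟩≈f : ∀ {m} (f : ℝ^𝓛 m) k → ⟨ f , e k ⟩ ≈ f k
  ⟨f,e⟩≈f f []          = *-identityʳ _
  ⟨f,e⟩≈f f (false ∷ k) =
    trans (+-cong (⟨f,e⟩≈f (f ∘ (false ∷_)) k) (∑𝓛-zero (λ l → zeroʳ (f (true ∷ l))))) (+-identityʳ _)
  ⟨f,e⟩≈f f (true ∷ k)  =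
    trans (+-cong (∑𝓛-zero (λ l → zeroʳ (f (false ∷ l)))) (⟨f,e⟩≈f (f ∘ (true ∷_)) k)) (+-identityˡ _)

  ⟨e,x⟩≈x : ∀ {m} (x : ℝ^𝓛 m) k → ⟨ e k , x ⟩ ≈ x k
  ⟨e,x⟩≈x x k = trans (⟨⟩-comm (e k) x) (⟨f,e⟩≈f x k)

  0≤e : ∀ {m} (k l : 𝓛 m) → 0# ≤ e k l
  0≤e k l with does (≡-dec Bool._≟_ k l)
  ... | true  = 0≤1
  ... | false = ≤-refl

  -- Fourier–Motzkin elimination

  -- Formal affine functionals on V, of which nonnegative combinations can be
  -- formed.
  record Functionals (V : Set c) : Set (lsuc c ⊔ ℓ₁) where
    infixl 6 _⊕_
    infixl 7 _⊙_
    field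
      Form   : Set c
      ⟦_⟧    : Form → V → Carrier
      _⊕_    : Form → Form → Form
      _⊙_    : Carrier → Form → Form
      ⊕-homo : ∀ g h y → ⟦ g ⊕ h ⟧ y ≈ ⟦ g ⟧ y + ⟦ h ⟧ y
      ⊙-homo : ∀ p g y → ⟦ p ⊙ g ⟧ y ≈ p * ⟦ g ⟧ y

    Holds : V → Form → Set ℓ₂
    Holds y g = 0# ≤ ⟦ g ⟧ y

    Polyhedral : ∀ {p} → Pred V p → Set (c ⊔ ℓ₂ ⊔ p)
    Polyhedral Q = ∃[ gs ] (∀ y → All (Holds y) gs ⇔ Q y)

  open Functionals
  open Equivalence using (to; from)

  affineOnLine : Functionals Carrier
  affineOnLine = record
    { Form   = Carrier × Carrier
    ; ⟦_⟧    = λ (p , q) v → p * v + q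
    ; _⊕_    = λ (p , q) (r , s) → p + r , q + s
    ; _⊙_    = λ t (p , q) → t * p , t * q
    ; ⊕-homo = λ (p , q) (r , s) v →
        solve 5 (λ p q r s v → (p :+ r) :* v :+ (q :+ s) := (p :* v :+ q) :+ (r :* v :+ s)) refl p q r s v
    ; ⊙-homo = λ t (p , q) v →
        solve 4 (λ t p q v → t :* p :* v :+ t :* q := t :* (p :* v :+ q)) refl t p q v
    }

  module _ (m : ℕ) {V : Set c} (𝓕 : Functionals V) where
    private module 𝓕 = Functionals 𝓕

    withDensity : Functionals (ℝ^𝓛 m × V)
    withDensity = record
      { Form   = ℝ^𝓛 m × 𝓕.Form
      ; ⟦_⟧    = λ (a , g) (x , y) → ⟨ a , x ⟩ + 𝓕.⟦ g ⟧ y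
      ; _⊕_    = λ (a , g) (a′ , g′) → (λ l → a l + a′ l) , g 𝓕.⊕ g′
      ; _⊙_    = λ p (a , g) → (λ l → p * a l) , p 𝓕.⊙ g
      ; ⊕-homo = λ (a , g) (a′ , g′) (x , y) →
          trans (+-cong (⟨⟩-distribˡ-+ a a′ x) (𝓕.⊕-homo g g′ y))
                (solve 4 (λ w x y z → (w :+ x) :+ (y :+ z) := (w :+ y) :+ (x :+ z)) refl _ _ _ _)
      ; ⊙-homo = λ p (a , g) (x , y) →
          trans (+-cong (⟨⟩-*ˡ p a x) (𝓕.⊙-homo p g y)) (sym (distribˡ p _ _))
      }

  -- The witness is the maximum of `los` and of the number min(0, `ups`), so 0 is the default where
  -- nothing constrains it.
  between : (los ups : List Carrier) → All (λ lo → All (lo ≤_) ups) los →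
            ∃[ t ] All (_≤ t) los × All (t ≤_) ups
  between []         []         _ = 0# , [] , []
  between []         (up ∷ ups) _ with between [] ups []
  ... | t , _ , t≤ups with ≤-total t up
  ...   | inj₁ t≤up = t , [] , t≤up ∷ t≤ups
  ...   | inj₂ up≤t = up , [] , ≤-refl ∷ All.map (≤-trans up≤t) t≤ups
  between (lo ∷ los) ups (lo≤ups ∷ los≤ups) with between los ups los≤ups
  ... | t , los≤t , t≤ups with ≤-total lo t
  ...   | inj₁ lo≤t = t , lo≤t ∷ los≤t , t≤ups
  ...   | inj₂ t≤lo = lo , ≤-refl ∷ All.map (λ lo′≤t → ≤-trans lo′≤t t≤lo) los≤t , lo≤ups

  module _ {V : Set c} (𝓕 : Functionals V) where
    private module 𝓕 = Functionals 𝓕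

    -- A constraint a t + g ≥ 0 bounds t from below by -g/a if a > 0, from
    -- above by g/(-a) if a < 0, and leaves it free if a = 0.
    isolate : (cs : List (Carrier × 𝓕.Form)) →
              ∃[ los ] ∃[ ups ] ∃[ frees ] ∀ t y →
              All (λ (a , g) → 0# ≤ a * t + 𝓕.⟦ g ⟧ y) cs
              ⇔ (All (λ g → - 𝓕.⟦ g ⟧ y ≤ t) los × All (λ g → t ≤ 𝓕.⟦ g ⟧ y) ups × All (𝓕.Holds y) frees)
    isolate [] = [] , [] , [] , λ t y → mk⇔ (λ _ → [] , [] , []) (λ _ → [])
    isolate ((a , g) ∷ cs) with isolate cs | trichotomy a
    ... | los , ups , frees , cs⇔ | inj₁ 0<a =
      (a ⁻¹ 𝓕.⊙ g) ∷ los , ups , frees , λ t y → mk⇔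
        (λ { (h ∷ hs) → let ls , us , fs = to (cs⇔ t y) hs in toBound h ∷ ls , us , fs })
        (λ { (h ∷ ls , us , fs) → fromBound h ∷ from (cs⇔ t y) (ls , us , fs) })
      where
      bound≈ : ∀ {t y} → a * (t - (- 𝓕.⟦ a ⁻¹ 𝓕.⊙ g ⟧ y)) ≈ a * t + 𝓕.⟦ g ⟧ y
      bound≈ {t} {y} = begin
        a * (t - (- 𝓕.⟦ a ⁻¹ 𝓕.⊙ g ⟧ y)) ≈⟨ *-congˡ (+-congˡ (-‿cong (-‿cong (𝓕.⊙-homo _ g y)))) ⟩
        a * (t - (- (a ⁻¹ * 𝓕.⟦ g ⟧ y)))
          ≈⟨ solve 4 (λ a a⁻¹ t g → a :* (t :- (:- (a⁻¹ :* g))) := a :* t :+ (a :* a⁻¹) :* g)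
               refl a (a ⁻¹) t (𝓕.⟦ g ⟧ y) ⟩
        a * t + a * a ⁻¹ * 𝓕.⟦ g ⟧ y
          ≈⟨ +-congˡ (trans (*-congʳ (*-inverseʳ a (0<x⇒x≉0 0<a))) (*-identityˡ _)) ⟩
        a * t + 𝓕.⟦ g ⟧ y                ∎
      toBound : ∀ {t y} → 0# ≤ a * t + 𝓕.⟦ g ⟧ y → - 𝓕.⟦ a ⁻¹ 𝓕.⊙ g ⟧ y ≤ t
      toBound h = 0≤y-x⇒x≤y (*-cancel-nonNegative 0<a (≤-respʳ-≈ (sym bound≈) h))
      fromBound : ∀ {t y} → - 𝓕.⟦ a ⁻¹ 𝓕.⊙ g ⟧ y ≤ t → 0# ≤ a * t + 𝓕.⟦ g ⟧ y
      fromBound h = ≤-respʳ-≈ bound≈ (*-nonNegative (proj₁ 0<a) (x≤y⇒0≤y-x h))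
    ... | los , ups , frees , cs⇔ | inj₂ (inj₂ 0<-a) =
      los , ((- a) ⁻¹ 𝓕.⊙ g) ∷ ups , frees , λ t y → mk⇔
        (λ { (h ∷ hs) → let ls , us , fs = to (cs⇔ t y) hs in ls , toBound h ∷ us , fs })
        (λ { (ls , h ∷ us , fs) → fromBound h ∷ from (cs⇔ t y) (ls , us , fs) })
      where
      bound≈ : ∀ {t y} → - a * (𝓕.⟦ (- a) ⁻¹ 𝓕.⊙ g ⟧ y - t) ≈ a * t + 𝓕.⟦ g ⟧ y
      bound≈ {t} {y} = begin
        - a * (𝓕.⟦ (- a) ⁻¹ 𝓕.⊙ g ⟧ y - t)   ≈⟨ *-congˡ (+-congʳ (𝓕.⊙-homo _ g y)) ⟩
        - a * ((- a) ⁻¹ * 𝓕.⟦ g ⟧ y - t)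
          ≈⟨ solve 4 (λ a a⁻¹ t g → (:- a) :* (a⁻¹ :* g :- t) := a :* t :+ ((:- a) :* a⁻¹) :* g)
               refl a ((- a) ⁻¹) t (𝓕.⟦ g ⟧ y) ⟩
        a * t + - a * (- a) ⁻¹ * 𝓕.⟦ g ⟧ y
          ≈⟨ +-congˡ (trans (*-congʳ (*-inverseʳ (- a) (0<x⇒x≉0 0<-a))) (*-identityˡ _)) ⟩
        a * t + 𝓕.⟦ g ⟧ y                    ∎
      toBound : ∀ {t y} → 0# ≤ a * t + 𝓕.⟦ g ⟧ y → t ≤ 𝓕.⟦ (- a) ⁻¹ 𝓕.⊙ g ⟧ y
      toBound h = 0≤y-x⇒x≤y (*-cancel-nonNegative 0<-a (≤-respʳ-≈ (sym bound≈) h))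
      fromBound : ∀ {t y} → t ≤ 𝓕.⟦ (- a) ⁻¹ 𝓕.⊙ g ⟧ y → 0# ≤ a * t + 𝓕.⟦ g ⟧ y
      fromBound h = ≤-respʳ-≈ bound≈ (*-nonNegative (proj₁ 0<-a) (x≤y⇒0≤y-x h))
    ... | los , ups , frees , cs⇔ | inj₂ (inj₁ a≈0) =
      los , ups , g ∷ frees , λ t y → mk⇔
        (λ { (h ∷ hs) → let ls , us , fs = to (cs⇔ t y) hs in ls , us , ≤-respʳ-≈ free≈ h ∷ fs })
        (λ { (ls , us , h ∷ fs) → ≤-respʳ-≈ (sym free≈) h ∷ from (cs⇔ t y) (ls , us , fs) })
      where
      free≈ : ∀ {t y} → a * t + 𝓕.⟦ g ⟧ y ≈ 𝓕.⟦ g ⟧ y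
      free≈ = trans (+-congʳ (trans (*-congʳ a≈0) (zeroˡ _))) (+-identityˡ _)

    -- A solution `t` exists as soon as each lower bound is at most each upper bound, by `between`.
    -- Lower bounds are stored negated, so this condition on a pair is nonnegativity of the single
    -- form `lo ⊕ up`.
    eliminateVariable : (cs : List (Carrier × 𝓕.Form)) →
      𝓕.Polyhedral (λ y → ∃[ t ] All (λ (a , g) → 0# ≤ a * t + 𝓕.⟦ g ⟧ y) cs)
    eliminateVariable cs with isolate cs
    ... | los , ups , frees , cs⇔ = pairs ++ frees , λ y → mk⇔ (solvable y) (necessary y)
      where
      pairs : List 𝓕.Form
      pairs = List.concat (List.map (λ lo → List.map (lo 𝓕.⊕_) ups) los)

      pair≈ : ∀ lo up y → 𝓕.⟦ up ⟧ y - (- 𝓕.⟦ lo ⟧ y) ≈ 𝓕.⟦ lo 𝓕.⊕ up ⟧ y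
      pair≈ lo up y =
        trans (solve 2 (λ x y → y :- (:- x) := x :+ y) refl _ _) (sym (𝓕.⊕-homo lo up y))

      solvable : ∀ y → All (𝓕.Holds y) (pairs ++ frees) → ∃[ t ] All (λ (a , g) → 0# ≤ a * t + 𝓕.⟦ g ⟧ y) cs
      solvable y holds with All.++⁻ pairs holds
      ... | pairsHold , freesHold
        with between (List.map (λ g → - 𝓕.⟦ g ⟧ y) los) (List.map (λ g → 𝓕.⟦ g ⟧ y) ups)
               (All.map⁺ (All.map
                 (λ {lo} hs → All.map⁺ (All.map
                   (λ {up} h → 0≤y-x⇒x≤y (≤-respʳ-≈ (sym (pair≈ lo up y)) h)) (All.map⁻ hs)))
                 (All.map⁻ {xs = los} (All.concat⁻ pairsHold))))
      ...   | t , los≤t , t≤ups = t , from (cs⇔ t y) (All.map⁻ los≤t , All.map⁻ t≤ups , freesHold)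

      necessary : ∀ y → ∃[ t ] All (λ (a , g) → 0# ≤ a * t + 𝓕.⟦ g ⟧ y) cs → All (𝓕.Holds y) (pairs ++ frees)
      necessary y (t , holds) with to (cs⇔ t y) holds
      ... | los≤t , t≤ups , freesHold = All.++⁺
        (All.concat⁺ (All.map⁺ (All.map
          (λ {lo} lo≤t → All.map⁺ (All.map
            (λ {up} t≤up → ≤-respʳ-≈ (pair≈ lo up y) (x≤y⇒0≤y-x (≤-trans lo≤t t≤up))) t≤ups)) los≤t)))
        freesHold

  -- A function on `𝓛 (suc m)` is a pair of functions on `𝓛 m`, split by the first bit. The `false`
  -- half is eliminated while the `true` half counts as a parameter, and then the `true` half in
  -- turn; hence the arbitrary parameter space `V`. On `𝓛 zero` a function is one number.
  eliminateDensity : ∀ m {V : Set c} (𝓕 : Functionals V) (cs : List (ℝ^𝓛 m × Form 𝓕)) →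
    Polyhedral 𝓕 (λ y → ∃[ x ] All (Holds (withDensity m 𝓕) (x , y)) cs)
  eliminateDensity zero 𝓕 cs with eliminateVariable 𝓕 (List.map (λ (a , g) → a [] , g) cs)
  ... | gs , gs⇔ = gs , λ y → mk⇔
    (λ hs → let t , holds = to (gs⇔ y) hs in (λ _ → t) , All.map⁻ holds)
    (λ (x , holds) → from (gs⇔ y) (x [] , All.map⁺ holds))
  eliminateDensity (suc m) {V} 𝓕 cs
    with eliminateDensity m (withDensity m 𝓕)
           (List.map (λ (a , g) → (λ l → a (false ∷ l)) , (λ l → a (true ∷ l)) , g) cs)
  ... | cs′ , cs′⇔ with eliminateDensity m 𝓕 cs′
  ...   | gs , gs⇔ = gs , λ y → mk⇔
    (λ hs → let x₁ , holds₁ = to (gs⇔ y) hs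
                x₀ , holds₀ = to (cs′⇔ (x₁ , y)) holds₁
            in glue x₀ x₁ , All.map (≤-respʳ-≈ (sym (+-assoc _ _ _))) (All.map⁻ holds₀))
    (λ (x , holds) → from (gs⇔ y) (x ∘ (true ∷_) , from (cs′⇔ _)
      (x ∘ (false ∷_) , All.map⁺ (All.map (≤-respʳ-≈ (+-assoc _ _ _)) holds))))
    where
    glue : ℝ^𝓛 m → ℝ^𝓛 m → ℝ^𝓛 (suc m)
    glue x₀ x₁ (false ∷ l) = x₀ l
    glue x₀ x₁ (true ∷ l)  = x₁ l

  polyhedral-∃ : ∀ {p m} {V : Set c} (𝓕 : Functionals V) {Q : Pred (ℝ^𝓛 m × V) p} →
    Polyhedral (withDensity m 𝓕) Q → Polyhedral 𝓕 (λ y → ∃[ x ] Q (x , y))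
  polyhedral-∃ {m = m} 𝓕 (cs , cs⇔) with eliminateDensity m 𝓕 cs
  ... | gs , gs⇔ = gs , λ y → mk⇔
    (λ hs → let x , holds = to (gs⇔ y) hs in x , to (cs⇔ (x , y)) holds)
    (λ (x , q) → from (gs⇔ y) (x , from (cs⇔ (x , y)) q))

  -- Closure properties of polyhedral predicates

  module _ {V : Set c} {𝓕 : Functionals V} where
    private module 𝓕 = Functionals 𝓕

    polyhedral-≤ : ∀ {f g : V → Carrier} (h : 𝓕.Form) → (∀ y → 𝓕.⟦ h ⟧ y ≈ g y - f y) →
                   𝓕.Polyhedral (λ y → f y ≤ g y)
    polyhedral-≤ h h≈ = h ∷ [] , λ y → mk⇔
      (λ { (p ∷ []) → 0≤y-x⇒x≤y (≤-respʳ-≈ (h≈ y) p) })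
      (λ p → ≤-respʳ-≈ (sym (h≈ y)) (x≤y⇒0≤y-x p) ∷ [])

    polyhedral-× : ∀ {p q} {Q : Pred V p} {R : Pred V q} →
                   𝓕.Polyhedral Q → 𝓕.Polyhedral R → 𝓕.Polyhedral (λ y → Q y × R y)
    polyhedral-× (gs , gs⇔) (hs , hs⇔) = gs ++ hs , λ y → mk⇔
      (λ p → let p₁ , p₂ = All.++⁻ gs p in to (gs⇔ y) p₁ , to (hs⇔ y) p₂)
      (λ (q , r) → All.++⁺ (from (gs⇔ y) q) (from (hs⇔ y) r))

    polyhedral-⇔ : ∀ {p q} {Q : Pred V p} {R : Pred V q} → (∀ y → Q y ⇔ R y) →
                   𝓕.Polyhedral Q → 𝓕.Polyhedral R
    polyhedral-⇔ Q⇔R (gs , gs⇔) = gs , λ y → mk⇔ (to (Q⇔R y) ∘ to (gs⇔ y)) (from (gs⇔ y) ∘ from (Q⇔R y))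

    polyhedral-≈ : ∀ {f g : V → Carrier} (h : 𝓕.Form) → (∀ y → 𝓕.⟦ h ⟧ y ≈ g y - f y) →
                   𝓕.Polyhedral (λ y → f y ≈ g y)
    polyhedral-≈ {f} {g} h h≈ = polyhedral-⇔
      (λ y → mk⇔ (λ (p , q) → ≤-antisym p q) (λ eq → ≤-reflexive eq , ≤-reflexive (sym eq)))
      (polyhedral-×
        (polyhedral-≤ h h≈)
        (polyhedral-≤ ((- 1#) 𝓕.⊙ h) (λ y → trans (trans (𝓕.⊙-homo _ h y) (*-congˡ (h≈ y)))
          (solve 2 (λ f g → (:- :1) :* (g :- f) := f :- g) refl (f y) (g y)))))

    polyhedral-∀Fin : ∀ {n p} {Q : Fin n → Pred V p} → (∀ i → 𝓕.Polyhedral (Q i)) →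
                      𝓕.Polyhedral (λ y → ∀ i → Q i y)
    polyhedral-∀Fin {zero}  h = [] , λ y → mk⇔ (λ _ ()) (λ _ → [])
    polyhedral-∀Fin {suc n} h = polyhedral-⇔
      (λ y → mk⇔ (λ { (p , ps) zero → p ; (p , ps) (suc i) → ps i }) (λ ps → ps zero , ps ∘ suc))
      (polyhedral-× (h zero) (polyhedral-∀Fin (h ∘ suc)))

    polyhedral-∀𝓛 : ∀ {n p} {Q : 𝓛 n → Pred V p} → (∀ l → 𝓕.Polyhedral (Q l)) →
                    𝓕.Polyhedral (λ y → ∀ l → Q l y)
    polyhedral-∀𝓛 {zero}  h = polyhedral-⇔ (λ y → mk⇔ (λ { p [] → p }) (λ p → p [])) (h [])
    polyhedral-∀𝓛 {suc n} h = polyhedral-⇔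
      (λ y → mk⇔ (λ { (p , q) (false ∷ l) → p l ; (p , q) (true ∷ l) → q l })
                 (λ p → p ∘ (false ∷_) , p ∘ (true ∷_)))
      (polyhedral-× (polyhedral-∀𝓛 (h ∘ (false ∷_))) (polyhedral-∀𝓛 (h ∘ (true ∷_))))

  -- The whole segment [v, v₀] is carried along so that raising v to meet one
  -- more constraint keeps the earlier ones.
  leastSolution : (cs : List (Carrier × Carrier)) → ∀ v₀ → 0# ≤ v₀ → All (Holds affineOnLine v₀) cs →
    ∃[ v ] 0# ≤ v × v ≤ v₀
         × (∀ w → v ≤ w → w ≤ v₀ → All (Holds affineOnLine w) cs)
         × (∀ w → 0# ≤ w → All (Holds affineOnLine w) cs → v ≤ w)
  -- The floor 0 guarantees a least solution even if no constraint bounds from below; expectations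
  -- of a nonnegative `u` respect it.
  leastSolution [] v₀ 0≤v₀ _ = 0# , ≤-refl , 0≤v₀ , (λ _ _ _ → []) , (λ _ 0≤w _ → 0≤w)
  leastSolution ((p , q) ∷ cs) v₀ 0≤v₀ (h₀ ∷ hs₀) with leastSolution cs v₀ 0≤v₀ hs₀
  ... | v , 0≤v , v≤v₀ , solves , least with ≤-total 0# (p * v + q) | trichotomy p
  ...   | inj₁ h | inj₁ 0<p =
    v , 0≤v , v≤v₀
    , (λ w v≤w w≤v₀ → ≤-trans h (+-mono-≤ (*-monoˡ-≤ (proj₁ 0<p) v≤w) ≤-refl) ∷ solves w v≤w w≤v₀)
    , (λ { w 0≤w (_ ∷ hs) → least w 0≤w hs })
  -- The increasing constraint is violated or tight at `v`, so the least solution moves up to its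
  -- root `v′`, which stays below `v₀` because `v₀` satisfies the constraint.
  ...   | inj₂ h | inj₁ 0<p =
    v′ , ≤-trans 0≤v v≤v′ , v′-least v₀ h₀
    , (λ w v′≤w w≤v₀ → ≤-respʳ-≈ (slack w) (*-nonNegative (proj₁ 0<p) (x≤y⇒0≤y-x v′≤w))
                       ∷ solves w (≤-trans v≤v′ v′≤w) w≤v₀)
    , (λ { w 0≤w (h′ ∷ _) → v′-least w h′ })
    where
    v′ : Carrier
    v′ = - (p ⁻¹ * q)
    slack : ∀ w → p * (w - v′) ≈ p * w + q
    slack w = trans
      (solve 4 (λ p p⁻¹ q w → p :* (w :- (:- (p⁻¹ :* q))) := p :* w :+ (p :* p⁻¹) :* q) refl p (p ⁻¹) q w)
      (+-congˡ (trans (*-congʳ (*-inverseʳ p (0<x⇒x≉0 0<p))) (*-identityˡ q)))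
    v′-least : ∀ w → 0# ≤ p * w + q → v′ ≤ w
    v′-least w h′ = 0≤y-x⇒x≤y (*-cancel-nonNegative 0<p (≤-respʳ-≈ (sym (slack w)) h′))
    v≤v′ : v ≤ v′
    v≤v′ = 0≤y-x⇒x≤y (*-cancel-nonNegative 0<p (≤-respʳ-≈
      (trans (-‿cong (sym (slack v))) (solve 3 (λ p v v′ → :- (p :* (v :- v′)) := p :* (v′ :- v)) refl p v v′))
      (x≤0⇒0≤-x h)))
  -- A constraint with slope `p ≤ 0` can only relax as the value decreases, so it passes from `v₀`
  -- to the whole segment.
  ...   | _ | inj₂ p≤0 =
    v , 0≤v , v≤v₀
    , (λ w v≤w w≤v₀ → ≤-trans h₀ (0≤d⇒x≤x+d (*-nonNegative (0≤-p p≤0) (x≤y⇒0≤y-x w≤v₀))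
                        (solve 4 (λ p q w v₀ → p :* w :+ q := (p :* v₀ :+ q) :+ (:- p) :* (v₀ :- w)) refl p q w v₀))
                      ∷ solves w v≤w w≤v₀)
    , (λ { w 0≤w (_ ∷ hs) → least w 0≤w hs })
    where
    0≤-p : p ≈ 0# ⊎ 0# < - p → 0# ≤ - p
    0≤-p (inj₁ p≈0)  = x≤0⇒0≤-x (≤-reflexive p≈0)
    0≤-p (inj₂ 0<-p) = proj₁ 0<-p

  -- Eliminating `x` from `x ∈ P b` and `⟨ u , x ⟩ ≤ v` leaves finitely many inequalities in `v`,
  -- solved by the expectation at `x₀`. At the least solution `v` some `x ∈ P b` has expectation at
  -- most `v`; that expectation is itself a solution, hence equal to `v`.
  minimum-exists : ∀ {m} (b : Vector Carrier m) {u x₀ : ℝ^𝓛 m} → (∀ l → 0# ≤ u l) → x₀ ∈ P b →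
                   ∃[ v ] IsMinimum (E-values b u) v
  minimum-exists {m} b {u} {x₀} 0≤u x₀∈P =
    v , (x , x∈P , ≤-antisym (least _ (⟨⟩-nonNegative 0≤u (proj₁ x∈P)) (from (cs⇔ _) (x , x∈P , ≤-refl))) Ex≤v)
      , λ { w (y , y∈P , w≈Ey) → least w
              (≤-respʳ-≈ (sym w≈Ey) (⟨⟩-nonNegative 0≤u (proj₁ y∈P)))
              (from (cs⇔ w) (y , y∈P , ≤-reflexive (sym w≈Ey))) }
    where
    𝓖 : Functionals (ℝ^𝓛 m × Carrier)
    𝓖 = withDensity m affineOnLine

    moment : ∀ f p → Polyhedral 𝓖 (λ (x , v) → ⟨ f , x ⟩ ≈ p)
    moment f p = polyhedral-≈ {𝓕 = 𝓖} ((λ l → - 1# * f l) , 0# , p) λ (x , v) → trans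
      (+-congʳ (⟨⟩-*ˡ (- 1#) f x))
      (solve 3 (λ y v p → (:- :1) :* y :+ (:0 :* v :+ p) := p :- y) refl ⟨ f , x ⟩ v p)

    feasible : Polyhedral affineOnLine (λ v → ∃[ x ] x ∈ P b × ⟨ u , x ⟩ ≤ v)
    feasible = polyhedral-∃ affineOnLine (polyhedral-× {𝓕 = 𝓖}
      (polyhedral-× {𝓕 = 𝓖}
        (polyhedral-∀𝓛 {𝓕 = 𝓖} λ l → polyhedral-≤ {𝓕 = 𝓖} (e l , 0# , 0#) λ (x , v) → trans
          (+-congʳ (⟨e,x⟩≈x x l)) (solve 2 (λ y v → y :+ (:0 :* v :+ :0) := y :- :0) refl (x l) v))
        (polyhedral-× {𝓕 = 𝓖} (moment (ℓ zero) 1#) (polyhedral-∀Fin {𝓕 = 𝓖} λ i → moment (ℓ (suc i)) (b i))))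
      (polyhedral-≤ {𝓕 = 𝓖} ((λ l → - 1# * u l) , 1# , 0#) λ (x , v) → trans
        (+-congʳ (⟨⟩-*ˡ (- 1#) u x))
        (solve 2 (λ y v → (:- :1) :* y :+ (:1 :* v :+ :0) := v :- y) refl ⟨ u , x ⟩ v)))

    cs = proj₁ feasible
    cs⇔ = proj₂ feasible

    least-v = leastSolution cs ⟨ u , x₀ ⟩ (⟨⟩-nonNegative 0≤u (proj₁ x₀∈P))
                (from (cs⇔ _) (x₀ , x₀∈P , ≤-refl))
    v = proj₁ least-v
    least = proj₂ (proj₂ (proj₂ (proj₂ least-v)))

    attained : ∃[ x ] x ∈ P b × ⟨ u , x ⟩ ≤ v
    attained = let _ , _ , v≤v₀ , solves , _ = least-v in to (cs⇔ v) (solves v ≤-refl v≤v₀)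

    x = proj₁ attained
    x∈P = proj₁ (proj₂ attained)
    Ex≤v = proj₂ (proj₂ attained)

  -- Affine functionals of the indicators of λ(i) = 0

  ½ : Carrier
  ½ = 2# ⁻¹

  2½≈1 : 2# * ½ ≈ 1#
  2½≈1 = *-inverseʳ 2# (0<x⇒x≉0 0<2)

  0≤½ : 0# ≤ ½
  0≤½ = 0≤x⁻¹ 0<2

  ind : ∀ {m} → Fin m → ℝ^𝓛 m
  ind i l = if lookup l i then 0# else 1#

  affine : ∀ {m} → Carrier → Vector Carrier m → ℝ^𝓛 m
  affine {m} p d l = p + ∑[ i < m ] (d i * ind i l)

  0≤ind : ∀ {m} (i : Fin m) l → 0# ≤ ind i l
  0≤ind i l with lookup l i
  ... | true  = ≤-refl
  ... | false = 0≤1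

  ℓ≈2ind-1 : ∀ {m} (i : Fin m) l → ℓ (suc i) l ≈ 2# * ind i l + - 1# * ℓ zero l
  ℓ≈2ind-1 i l with lookup l i
  ... | true  = solve 0 (:- :1 := :2 :* :0 :+ (:- :1) :* :1) refl
  ... | false = solve 0 (:1 := :2 :* :1 :+ (:- :1) :* :1) refl

  ind≈½[ℓ+1] : ∀ {m} (i : Fin m) l → ind i l ≈ ½ * (ℓ (suc i) l + ℓ zero l)
  ind≈½[ℓ+1] i l with lookup l i
  ... | true  = solve 1 (λ h → :0 := h :* (:- :1 :+ :1)) refl ½
  ... | false = sym (trans (*-comm _ _) 2½≈1)

  -- The probability of λ(i) = 0 when the expectation of ℓ_i is b(i).
  β : ∀ {m} → Vector Carrier m → Vector Carrier m
  β b i = (b i + 1#) / 2#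

  ⟨ind,x⟩≈β : ∀ {m} (b : Vector Carrier m) {x} → x ∈ P b → ∀ i → ⟨ ind i , x ⟩ ≈ β b i
  ⟨ind,x⟩≈β b {x} (_ , total , moments) i = begin
    ⟨ ind i , x ⟩                                        ≈⟨ ⟨⟩-congˡ x (ind≈½[ℓ+1] i) ⟩
    ⟨ (λ l → ½ * (ℓ (suc i) l + ℓ zero l)) , x ⟩         ≈⟨ ⟨⟩-*ˡ ½ (λ l → ℓ (suc i) l + ℓ zero l) x ⟩
    ½ * ⟨ (λ l → ℓ (suc i) l + ℓ zero l) , x ⟩           ≈⟨ *-congˡ (⟨⟩-distribˡ-+ (ℓ (suc i)) (ℓ zero) x) ⟩
    ½ * (⟨ ℓ (suc i) , x ⟩ + ⟨ ℓ zero , x ⟩)             ≈⟨ *-congˡ (+-cong (moments i) total) ⟩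
    ½ * (b i + 1#)                                       ≈⟨ *-comm _ _ ⟩
    β b i                                                ∎

  ∈P-from-ind : ∀ {m} (b : Vector Carrier m) {x} → (∀ l → 0# ≤ x l) → ⟨ ℓ zero , x ⟩ ≈ 1# →
                (∀ i → ⟨ ind i , x ⟩ ≈ β b i) → x ∈ P b
  ∈P-from-ind b {x} 0≤x total probabilities = 0≤x , total , λ i → begin
    ⟨ ℓ (suc i) , x ⟩                                            ≈⟨ ⟨⟩-congˡ x (ℓ≈2ind-1 i) ⟩
    ⟨ (λ l → 2# * ind i l + - 1# * ℓ zero l) , x ⟩
      ≈⟨ ⟨⟩-distribˡ-+ (λ l → 2# * ind i l) (λ l → - 1# * ℓ zero l) x ⟩
    ⟨ (λ l → 2# * ind i l) , x ⟩ + ⟨ (λ l → - 1# * ℓ zero l) , x ⟩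
      ≈⟨ +-cong (⟨⟩-*ˡ 2# (ind i) x) (⟨⟩-*ˡ (- 1#) (ℓ zero) x) ⟩
    2# * ⟨ ind i , x ⟩ + - 1# * ⟨ ℓ zero , x ⟩
      ≈⟨ +-cong (*-congˡ (probabilities i)) (*-congˡ total) ⟩
    2# * ((b i + 1#) * ½) + - 1# * 1#
      ≈⟨ solve 2 (λ b h → :2 :* ((b :+ :1) :* h) :+ (:- :1) :* :1 := (:2 :* h) :* (b :+ :1) :- :1)
           refl (b i) ½ ⟩
    2# * ½ * (b i + 1#) - 1#                                     ≈⟨ +-congʳ (*-congʳ 2½≈1) ⟩
    1# * (b i + 1#) - 1#
      ≈⟨ solve 1 (λ b → :1 :* (b :+ :1) :- :1 := b) refl (b i) ⟩
    b i                                                          ∎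

  ⟨affine,x⟩ : ∀ {m} (b : Vector Carrier m) {x} → x ∈ P b → ∀ p d →
               ⟨ affine p d , x ⟩ ≈ p + ∑[ i < m ] (d i * β b i)
  ⟨affine,x⟩ {m} b {x} x∈P@(_ , total , _) p d = begin
    ⟨ affine p d , x ⟩
      ≈⟨ ⟨⟩-congˡ x (λ l → +-congʳ (sym (*-identityʳ p))) ⟩
    ⟨ (λ l → p * ℓ zero l + ∑[ i < m ] (d i * ind i l)) , x ⟩
      ≈⟨ ⟨⟩-distribˡ-+ (λ l → p * ℓ zero l) (λ l → ∑[ i < m ] (d i * ind i l)) x ⟩
    ⟨ (λ l → p * ℓ zero l) , x ⟩ + ⟨ (λ l → ∑[ i < m ] (d i * ind i l)) , x ⟩
      ≈⟨ +-cong (⟨⟩-*ˡ p (ℓ zero) x) (⟨⟩-sumˡ (λ i l → d i * ind i l) x) ⟩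
    p * ⟨ ℓ zero , x ⟩ + ∑[ i < m ] ⟨ (λ l → d i * ind i l) , x ⟩
      ≈⟨ +-cong (trans (*-congˡ total) (*-identityʳ p))
                (sum-cong-≋ (λ i → trans (⟨⟩-*ˡ (d i) (ind i) x) (*-congˡ (⟨ind,x⟩≈β b x∈P i)))) ⟩
    p + ∑[ i < m ] (d i * β b i) ∎

  Uℓ-pos⇒affine : ∀ {m} {u : ℝ^𝓛 m} → u ∈ Uℓ-pos →
                  ∃[ p ] ∃[ a ] (∀ i → 0# ≤ a i) × (∀ l → u l ≈ affine p a l)
  Uℓ-pos⇒affine {m} {u} (a , 0<a , u≈) =
    -- Substituting `2# * ind i - 1#` for ℓ_i doubles each slope and moves the sum of the
    -- coefficients into the constant term.
    a zero - sum (a ∘ suc) , (λ i → 2# * a (suc i)) , (λ i → *-nonNegative (proj₁ 0<2) (proj₁ (0<a i))) , λ l → begin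
      u l
        ≈⟨ u≈ l ⟩
      a zero * 1# + ∑[ i < m ] (a (suc i) * ℓ (suc i) l)
        ≈⟨ +-congˡ (sum-cong-≋ (λ i → trans (*-congˡ (ℓ≈2ind-1 i l))
             (solve 2 (λ a x → a :* (:2 :* x :+ (:- :1) :* :1) := :2 :* a :* x :+ a :* (:- :1)) refl (a (suc i)) (ind i l)))) ⟩
      a zero * 1# + ∑[ i < m ] (2# * a (suc i) * ind i l + a (suc i) * - 1#)
        ≈⟨ +-congˡ (trans (∑-distrib-+ (λ i → 2# * a (suc i) * ind i l) (λ i → a (suc i) * - 1#))
                          (+-congˡ (sym (*-distribʳ-sum (- 1#) (a ∘ suc))))) ⟩
      a zero * 1# + (∑[ i < m ] (2# * a (suc i) * ind i l) + sum (a ∘ suc) * - 1#)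
        ≈⟨ solve 3 (λ a s t → a :* :1 :+ (s :+ t :* (:- :1)) := (a :- t) :+ s) refl (a zero) _ (sum (a ∘ suc)) ⟩
      affine (a zero - sum (a ∘ suc)) (λ i → 2# * a (suc i)) l ∎

  -- Finite mixtures of point masses

  module _ {m n} {w : Vector Carrier n} {κ : Fin n → 𝓛 m} {x : ℝ^𝓛 m}
           (mixture : ∀ l → x l ≈ ∑[ j < n ] (w j * e (κ j) l)) where

    -- The weights may have any sign, which covers a subvertex with negative weight at `ν zero`.
    ⟨f,mixture⟩ : ∀ f → ⟨ f , x ⟩ ≈ ∑[ j < n ] (w j * f (κ j))
    ⟨f,mixture⟩ f = begin
      ⟨ f , x ⟩                                        ≈⟨ ∑𝓛-cong (λ l → *-congˡ (mixture l)) ⟩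
      ⟨ f , (λ l → ∑[ j < n ] (w j * e (κ j) l)) ⟩     ≈⟨ ⟨⟩-sumʳ f (λ j l → w j * e (κ j) l) ⟩
      ∑[ j < n ] ⟨ f , (λ l → w j * e (κ j) l) ⟩
        ≈⟨ sum-cong-≋ (λ j → trans (⟨⟩-*ʳ (w j) f (e (κ j))) (*-congˡ (⟨f,e⟩≈f f (κ j)))) ⟩
      ∑[ j < n ] (w j * f (κ j))                       ∎

    0≤mixture : (∀ j → 0# ≤ w j) → ∀ l → 0# ≤ x l
    0≤mixture 0≤w l = ≤-respʳ-≈ (sym (mixture l)) (sum-nonNegative (λ j → *-nonNegative (0≤w j) (0≤e (κ j) l)))

  -- The chain μ_0, …, μ_m and the star ν_0, …, ν_m

  affine-cong : ∀ {m p q} {d d′ : Vector Carrier m} l → p ≈ q → (∀ i → d i ≈ d′ i) → affine p d l ≈ affine q d′ l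
  affine-cong l p≈q d≈d′ = +-cong p≈q (sum-cong-≋ (λ i → *-congʳ (d≈d′ i)))

  affine-true : ∀ {m} p (d : Vector Carrier (suc m)) l → affine p d (true ∷ l) ≈ affine p (d ∘ suc) l
  affine-true p d l = solve 3 (λ p d s → p :+ (d :* :0 :+ s) := p :+ s) refl p (d zero) _

  affine-false : ∀ {m} p (d : Vector Carrier (suc m)) l →
                 affine p d (false ∷ l) ≈ affine (p + d zero) (d ∘ suc) l
  affine-false p d l = solve 3 (λ p d s → p :+ (d :* :1 :+ s) := p :+ d :+ s) refl p (d zero) _

  -- Both `μ zero` and `ν zero` are the constant function 1, the base point where `affine p d` takes
  -- the value `p`.
  ind-μ₀ : ∀ {m} (i : Fin m) → ind i (μ zero) ≈ 0#
  ind-μ₀ i = reflexive (≡.cong (if_then 0# else 1#) (lookup∘tabulate _ i))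

  ind-ν₀ : ∀ {m} (i : Fin m) → ind i (ν zero) ≈ 0#
  ind-ν₀ i = reflexive (≡.cong (if_then 0# else 1#) (lookup∘tabulate _ i))

  affine-vanishing : ∀ {m} p (d : Vector Carrier m) l → (∀ i → ind i l ≈ 0#) → affine p d l ≈ p
  affine-vanishing p d l ind≈0 =
    trans (+-congˡ (sum-zero (λ i → trans (*-congˡ (ind≈0 i)) (zeroʳ (d i))))) (+-identityʳ p)

  affine-ν : ∀ {m} p (d : Vector Carrier m) k → affine p d (ν (suc k)) ≈ p + d k
  affine-ν p d zero    = trans (affine-false p d (ν zero)) (affine-vanishing _ (d ∘ suc) (ν zero) ind-ν₀)
  affine-ν p d (suc k) = trans (affine-true p d (ν (suc k))) (affine-ν p (d ∘ suc) k)

  ∑ind-ν : ∀ {m} (d : Vector Carrier m) i → ∑[ k < m ] (d k * ind i (ν (suc k))) ≈ d i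
  ∑ind-ν d zero    = trans
    (+-cong (*-identityʳ _) (sum-zero (λ k → zeroʳ (d (suc k))))) (+-identityʳ _)
  ∑ind-ν d (suc i) = trans
    (+-cong (trans (*-congˡ (ind-ν₀ i)) (zeroʳ _)) (∑ind-ν (d ∘ suc) i)) (+-identityˡ _)

  -- For `s = 1# ∷ b` and `t = - 1#` these are twice the weights `b′ b`. A general first entry lets
  -- inductions discard the head of `s`.
  drops : ∀ {m} → Vector Carrier (suc m) → Carrier → Vector Carrier (suc m)
  drops {m} s t j = s j - insertAt (Vector.tail s) (fromℕ m) t j

  ∑drops : ∀ {m} (s : Vector Carrier (suc m)) t → sum (drops s t) ≈ s zero - t
  ∑drops {zero}  s t = +-identityʳ _
  ∑drops {suc m} s t = trans (+-congˡ (∑drops (s ∘ suc) t))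
    (solve 3 (λ x y t → (x :- y) :+ (y :- t) := x :- t) refl (s zero) (s (suc zero)) t)

  -- The indicator `ind k (μ j)` is 1 exactly when `j ≥ suc k`, so a tail of the telescoping sum
  -- survives.
  ∑drops*ind-μ : ∀ {m} (s : Vector Carrier (suc m)) t (k : Fin m) →
                 ∑[ j ≤ m ] (drops s t j * ind k (μ j)) ≈ s (suc k) - t
  ∑drops*ind-μ {suc m} s t zero    = trans
    (+-cong (zeroʳ _) (trans (sum-cong-≋ (λ j → *-identityʳ (drops (s ∘ suc) t j))) (∑drops (s ∘ suc) t)))
    (+-identityˡ _)
  ∑drops*ind-μ {suc m} s t (suc k) = trans
    (+-cong (trans (*-congˡ (ind-μ₀ k)) (zeroʳ _)) (∑drops*ind-μ (s ∘ suc) t k)) (+-identityˡ _)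

  drops-nonNegative : ∀ {m} (s : Vector Carrier (suc m)) {t} → Decreasing s → (∀ j → t ≤ s j) →
                      ∀ j → 0# ≤ drops s t j
  drops-nonNegative {zero}  s dec t≤s zero    = x≤y⇒0≤y-x (t≤s zero)
  drops-nonNegative {suc m} s dec t≤s zero    = x≤y⇒0≤y-x (dec z≤n)
  drops-nonNegative {suc m} s dec t≤s (suc j) = drops-nonNegative (s ∘ suc) (dec ∘ s≤s) (t≤s ∘ suc) j

  -- Bounds for the truncation of an affine functional with nonnegative slopes

  -- Each increment on the left is taken from the base point `p`, the smallest possible one. For a
  -- `false` head the step `a zero` is taken last, from `p + S` with `S` the contribution of the
  -- other bits, and convexity makes it at least the step from `p`.
  pos-affine-≥ : ∀ {m} p {a : Vector Carrier m} → (∀ i → 0# ≤ a i) → ∀ l →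
                 affine (pos p) (λ i → pos (p + a i) - pos p) l ≤ pos (affine p a l)
  pos-affine-≥ p 0≤a [] = ≤-reflexive (trans (+-identityʳ _) (pos-cong (sym (+-identityʳ p))))
  pos-affine-≥ p {a} 0≤a (true ∷ l) =
    ≤-respˡ-≈ (sym (affine-true (pos p) (λ i → pos (p + a i) - pos p) l)) (≤-respʳ-≈ (pos-cong (sym (affine-true p a l)))
      (pos-affine-≥ p (0≤a ∘ suc) l))
  pos-affine-≥ {suc m} p {a} 0≤a (false ∷ l) =
    ≤-respˡ-≈ (solve 3 (λ p d s → d :+ (p :+ s) := p :+ (d :* :1 :+ s)) refl (pos p) _ _)
      (≤-respʳ-≈ eq
        (+-mono-≤ (pos-increment-mono (0≤d⇒x≤x+d 0≤S refl) (0≤a zero)) (pos-affine-≥ p (0≤a ∘ suc) l)))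
    where
    S : Carrier
    S = ∑[ i < m ] (a (suc i) * ind i l)
    0≤S : 0# ≤ S
    0≤S = sum-nonNegative (λ i → *-nonNegative (0≤a (suc i)) (0≤ind i l))
    eq : (pos (p + S + a zero) - pos (p + S)) + pos (p + S) ≈ pos (p + (a zero * 1# + S))
    eq = trans (solve 2 (λ x y → (x :- y) :+ y := x) refl _ _)
               (pos-cong (solve 3 (λ p s a → p :+ s :+ a := p :+ (a :* :1 :+ s)) refl p S (a zero)))

  -- Entry i is the rise of `pos ∘ affine p a` from `μ i` to `μ (suc i)`.
  increments : ∀ {m} → Carrier → Vector Carrier m → Vector Carrier m
  increments p a zero    = pos (p + a zero) - pos p
  increments p a (suc i) = increments (p + a zero) (a ∘ suc) i

  -- Two base points make the induction work: `p` advances only on `false` bits, `q` on every bit as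
  -- the full chain does. So `p ≤ q` persists, and convexity bounds each step from `p` by the same
  -- step from `q`.
  pos-affine-≤ : ∀ {m p q} {a : Vector Carrier m} → p ≤ q → (∀ i → 0# ≤ a i) → ∀ l →
                 pos (affine p a l) ≤ affine (pos p) (increments q a) l
  pos-affine-≤ p≤q 0≤a [] = ≤-reflexive (trans (pos-cong (+-identityʳ _)) (sym (+-identityʳ _)))
  pos-affine-≤ {p = p} {q} {a} p≤q 0≤a (true ∷ l) =
    ≤-respˡ-≈ (pos-cong (sym (affine-true p a l))) (≤-respʳ-≈ (sym (affine-true _ (increments q a) l))
      (pos-affine-≤ (≤-trans p≤q (0≤d⇒x≤x+d (0≤a zero) refl)) (0≤a ∘ suc) l))
  pos-affine-≤ {p = p} {q} {a} p≤q 0≤a (false ∷ l) =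
    ≤-respˡ-≈ (pos-cong (sym (affine-false p a l))) (≤-respʳ-≈ (sym (affine-false _ (increments q a) l))
      (≤-trans (pos-affine-≤ (+-mono-≤ p≤q ≤-refl) (0≤a ∘ suc) l)
        (+-mono-≤ (≤-respˡ-≈ (solve 2 (λ x y → y :+ (x :- y) := x) refl _ _)
                    (+-monoʳ-≤ (pos p) (pos-increment-mono p≤q (0≤a zero))))
                  ≤-refl)))

  pos-affine-μ : ∀ {m} p (a : Vector Carrier m) j →
                 pos (affine p a (μ j)) ≈ affine (pos p) (increments p a) (μ j)
  pos-affine-μ p a zero = trans (pos-cong (affine-vanishing p a (μ zero) ind-μ₀))
                                (sym (affine-vanishing (pos p) (increments p a) (μ zero) ind-μ₀))
  pos-affine-μ {suc m} p a (suc j) = begin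
    pos (affine p a (μ (suc j)))
      ≈⟨ pos-cong (affine-false p a (μ j)) ⟩
    pos (affine (p + a zero) (a ∘ suc) (μ j))
      ≈⟨ pos-affine-μ (p + a zero) (a ∘ suc) j ⟩
    affine (pos (p + a zero)) (increments p a ∘ suc) (μ j)
      ≈⟨ affine-cong {d = increments p a ∘ suc} (μ j) (solve 2 (λ x y → y := x :+ (y :- x)) refl (pos p) (pos (p + a zero))) (λ _ → refl) ⟩
    affine (pos p + increments p a zero) (increments p a ∘ suc) (μ j)
      ≈⟨ affine-false (pos p) (increments p a) (μ j) ⟨
    affine (pos p) (increments p a) (μ (suc j)) ∎

  0≤β : ∀ {m} {b : Vector Carrier m} → InUnitCube b → ∀ i → 0# ≤ β b i
  0≤β {b = b} cube i = *-nonNegative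
    (≤-respʳ-≈ (solve 1 (λ b → b :- (:- :1) := b :+ :1) refl (b i)) (x≤y⇒0≤y-x (proj₁ (cube i)))) 0≤½

  -- The subvertex

  module _ {m} (b : Vector Carrier m) (cube : InUnitCube b) where

    ⟨f,subvertex⟩ : ∀ f → ⟨ f , subvertex b ⟩ ≈ b″ b zero * f (ν zero) + ∑[ i < m ] (β b i * f (ν (suc i)))
    ⟨f,subvertex⟩ = ⟨f,mixture⟩ {w = b″ b} {κ = ν} {x = subvertex b} (λ _ → refl)

    -- The weight at `ν zero` is 1 minus the others, so the sum regroups around the value at the
    -- base point. The result is the expectation that every member of P(b) assigns to the
    -- interpolating functional.
    subvertex-value : ∀ p a → ⟨ (λ l → pos (affine p a l)) , subvertex b ⟩
                            ≈ pos p + ∑[ i < m ] ((pos (p + a i) - pos p) * β b i)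
    subvertex-value p a = begin
      ⟨ (λ l → pos (affine p a l)) , subvertex b ⟩
        ≈⟨ ⟨f,subvertex⟩ (λ l → pos (affine p a l)) ⟩
      b″ b zero * pos (affine p a (ν zero)) + ∑[ i < m ] (β b i * pos (affine p a (ν (suc i))))
        ≈⟨ +-cong (*-congˡ (pos-cong (affine-vanishing p a (ν zero) ind-ν₀)))
                  (sum-cong-≋ (λ i → trans (*-congˡ (pos-cong (affine-ν p a i)))
                    (solve 3 (λ β x y → β :* x := (x :- y) :* β :+ y :* β) refl (β b i) (pos (p + a i)) (pos p)))) ⟩
      b″ b zero * pos p + ∑[ i < m ] ((pos (p + a i) - pos p) * β b i + pos p * β b i)
        ≈⟨ +-congˡ (trans (∑-distrib-+ (λ i → (pos (p + a i) - pos p) * β b i) (λ i → pos p * β b i))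
                          (+-congˡ (sym (*-distribˡ-sum (pos p) (β b))))) ⟩
      b″ b zero * pos p + (∑[ i < m ] ((pos (p + a i) - pos p) * β b i) + pos p * sum (β b))
        ≈⟨ solve 3 (λ s t x → (:1 :- t) :* x :+ (s :+ x :* t) := x :+ s) refl _ (sum (β b)) (pos p) ⟩
      pos p + ∑[ i < m ] ((pos (p + a i) - pos p) * β b i) ∎

    -- A negative weight at `ν zero` does no harm: after the regrouping, every term is nonnegative
    -- because `pos` is monotone.
    subvertex-nonNegative : ∀ p {a} → (∀ i → 0# ≤ a i) → 0# ≤ ⟨ (λ l → pos (affine p a l)) , subvertex b ⟩
    subvertex-nonNegative p {a} 0≤a = ≤-respʳ-≈ (sym (subvertex-value p a))
      (+-nonNegative (0≤pos p) (sum-nonNegative (λ i → *-nonNegative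
        (x≤y⇒0≤y-x (pos-mono-≤ (0≤d⇒x≤x+d (0≤a i) refl))) (0≤β cube i))))

    subvertex-≤ : ∀ p {a} → (∀ i → 0# ≤ a i) → ∀ {x} → x ∈ P b →
                  ⟨ (λ l → pos (affine p a l)) , subvertex b ⟩ ≤ ⟨ (λ l → pos (affine p a l)) , x ⟩
    subvertex-≤ p {a} 0≤a {x} x∈P =
      ≤-respˡ-≈ (trans (⟨affine,x⟩ b x∈P (pos p) (λ i → pos (p + a i) - pos p)) (sym (subvertex-value p a)))
        (⟨⟩-monoˡ-≤ x (proj₁ x∈P) (pos-affine-≥ p 0≤a))

    -- The weight at `ν zero` equals half of `2# - fromNat m - sum b`; this is the origin of the
    -- bound 2 - m.
    0≤b″₀ : sum b ≤ 2# - fromNat m → 0# ≤ b″ b zero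
    0≤b″₀ ∑b≤2-m = ≤-respʳ-≈ eq (*-nonNegative (x≤y⇒0≤y-x ∑b≤2-m) 0≤½)
      where
      ∑β : sum (β b) ≈ (sum b + fromNat m) * ½
      ∑β = trans (sym (*-distribʳ-sum ½ (λ i → b i + 1#)))
                 (*-congʳ (trans (∑-distrib-+ b (λ _ → 1#)) (+-congˡ (sum-replicate m))))
      eq : (2# - fromNat m - sum b) * ½ ≈ b″ b zero
      eq = begin
        (2# - fromNat m - sum b) * ½
          ≈⟨ solve 3 (λ h n s → (:2 :- n :- s) :* h := :2 :* h :- (s :+ n) :* h) refl ½ (fromNat m) (sum b) ⟩
        2# * ½ - (sum b + fromNat m) * ½
          ≈⟨ +-cong 2½≈1 (-‿cong (sym ∑β)) ⟩
        b″ b zero ∎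

    subvertex∈P : sum b ≤ 2# - fromNat m → subvertex b ∈ P b
    subvertex∈P ∑b≤2-m = ∈P-from-ind b
      (0≤mixture {w = b″ b} {κ = ν} {x = subvertex b} (λ _ → refl)
        λ { zero → 0≤b″₀ ∑b≤2-m ; (suc i) → 0≤β cube i })
      (trans (⟨f,subvertex⟩ (ℓ zero)) (trans
        (+-congˡ (sum-cong-≋ (λ i → *-identityʳ (β b i))))
        (solve 1 (λ s → (:1 :- s) :* :1 :+ s := :1) refl (sum (β b)))))
      (λ i → trans (⟨f,subvertex⟩ (ind i)) (trans
        (+-cong (trans (*-congˡ (ind-ν₀ i)) (zeroʳ _)) (∑ind-ν (β b) i))
        (+-identityˡ _)))

  -- The supervertex

  ∘𝓛-cancel : ∀ {m} {f g : Fin m → Fin m} (l : 𝓛 m) → (∀ k → f (g k) ≡ k) → (l ∘𝓛 f) ∘𝓛 g ≡ l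
  ∘𝓛-cancel {g = g} l fg≡id = ≡.trans
    (tabulate-cong λ k → ≡.trans (lookup∘tabulate _ (g k)) (≡.cong (lookup l) (fg≡id k)))
    (tabulate∘lookup l)

  ind-∘𝓛 : ∀ {m} (f : Fin m → Fin m) i l → ind i (l ∘𝓛 f) ≡ ind (f i) l
  ind-∘𝓛 f i l = ≡.cong (if_then 0# else 1#) (lookup∘tabulate _ i)

  affine-permute : ∀ {m} (σ : Permutation′ m) p d l →
                   affine p d (l ∘𝓛 (σ ⟨$⟩ˡ_)) ≈ affine p (d ∘ (σ ⟨$⟩ʳ_)) l
  affine-permute {m} σ p d l = +-congˡ (trans
    (sum-permute (λ i → d i * ind i (l ∘𝓛 (σ ⟨$⟩ˡ_))) σ)
    (sum-cong-≋ λ i → *-congˡ (reflexive (≡.trans (ind-∘𝓛 (σ ⟨$⟩ˡ_) (σ ⟨$⟩ʳ i) l)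
      (≡.cong (λ k → ind k l) (Perm.inverseˡ σ))))))

  module _ {m} (b : Vector Carrier m) (cube : InUnitCube b) {q : ℝ^𝓛 m} (super : IsSupervertex b q) where
    private
      σ : Permutation′ m
      σ = proj₁ super

      s : Vector Carrier (suc m)
      s = 1# Vector.∷ (b ∘⁻¹ σ)

      κ : Fin (suc m) → 𝓛 m
      κ j = μ j ∘𝓛 (σ ⟨$⟩ʳ_)

      w : Vector Carrier (suc m)
      w = b′ (b ∘⁻¹ σ)

      e-κ : ∀ j l → e (μ j) (l ∘𝓛 (σ ⟨$⟩ˡ_)) ≡ e (κ j) l
      e-κ j l = ≡.cong (if_then 1# else 0#) (does-⇔ (mk⇔
        (λ eq → ≡.trans (≡.cong (_∘𝓛 (σ ⟨$⟩ʳ_)) eq) (∘𝓛-cancel l (λ _ → Perm.inverseˡ σ)))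
        (λ eq → ≡.trans (≡.sym (∘𝓛-cancel (μ j) (λ _ → Perm.inverseʳ σ))) (≡.cong (_∘𝓛 (σ ⟨$⟩ˡ_)) eq)))
        (≡-dec Bool._≟_ (μ j) (l ∘𝓛 (σ ⟨$⟩ˡ_))) (≡-dec Bool._≟_ (κ j) l))

      -- `IsSupervertex` prescribes `q` only at relabelled arguments; as relabelling by `σ` is
      -- invertible, these are all arguments, and the chain `μ` is carried to `κ`.
      q-mixture : ∀ l → q l ≈ ∑[ j ≤ m ] (w j * e (κ j) l)
      q-mixture l = begin
        q l                                                ≡⟨ ≡.cong q (∘𝓛-cancel l (λ _ → Perm.inverseˡ σ)) ⟨
        q ((l ∘𝓛 (σ ⟨$⟩ˡ_)) ∘𝓛 (σ ⟨$⟩ʳ_))                   ≈⟨ proj₂ (proj₂ super) (l ∘𝓛 (σ ⟨$⟩ˡ_)) ⟩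
        ∑[ j ≤ m ] (w j * e (μ j) (l ∘𝓛 (σ ⟨$⟩ˡ_)))
          ≈⟨ sum-cong-≋ (λ j → *-congˡ {w j} (reflexive (e-κ j l))) ⟩
        ∑[ j ≤ m ] (w j * e (κ j) l)                       ∎

      ⟨f,q⟩ : ∀ f → ⟨ f , q ⟩ ≈ ∑[ j ≤ m ] (w j * f (κ j))
      ⟨f,q⟩ = ⟨f,mixture⟩ {w = w} {κ = κ} {x = q} q-mixture

      s-decreasing : Decreasing s
      s-decreasing {zero}  {zero}  _         = ≤-refl
      s-decreasing {zero}  {suc j} _         = proj₂ (cube (σ ⟨$⟩ˡ j))
      s-decreasing {suc i} {suc j} (s≤s i≤j) = proj₁ (proj₂ super) i≤j

      -1≤s : ∀ j → - 1# ≤ s j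
      -1≤s zero    = ≤-trans (0≤-x⇒x≤0 (≤-respʳ-≈ (solve 0 (:1 := :- (:- :1)) refl) 0≤1)) 0≤1
      -1≤s (suc j) = proj₁ (cube (σ ⟨$⟩ˡ j))

    supervertex∈P : q ∈ P b
    supervertex∈P = ∈P-from-ind b
      (0≤mixture {w = w} {κ = κ} {x = q} q-mixture
        (λ j → *-nonNegative (drops-nonNegative s s-decreasing -1≤s j) 0≤½))
      total
      probabilities
      where
      total : ⟨ ℓ zero , q ⟩ ≈ 1#
      total = begin
        ⟨ ℓ zero , q ⟩                        ≈⟨ ⟨f,q⟩ (ℓ zero) ⟩
        ∑[ j ≤ m ] (w j * 1#)                 ≈⟨ sum-cong-≋ (λ j → *-identityʳ (w j)) ⟩
        ∑[ j ≤ m ] (drops s (- 1#) j * ½)     ≈⟨ *-distribʳ-sum ½ (drops s (- 1#)) ⟨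
        sum (drops s (- 1#)) * ½              ≈⟨ *-congʳ (∑drops s (- 1#)) ⟩
        (1# - (- 1#)) * ½                     ≈⟨ solve 1 (λ h → (:1 :- (:- :1)) :* h := :2 :* h) refl ½ ⟩
        2# * ½                                ≈⟨ 2½≈1 ⟩
        1#                                    ∎
      probabilities : ∀ i → ⟨ ind i , q ⟩ ≈ β b i
      probabilities i = begin
        ⟨ ind i , q ⟩
          ≈⟨ ⟨f,q⟩ (ind i) ⟩
        ∑[ j ≤ m ] (w j * ind i (κ j))
          ≈⟨ sum-cong-≋ (λ j → trans (*-congˡ (reflexive (ind-∘𝓛 (σ ⟨$⟩ʳ_) i (μ j))))
               (solve 3 (λ d h x → d :* h :* x := d :* x :* h) refl (drops s (- 1#) j) ½ (ind (σ ⟨$⟩ʳ i) (μ j)))) ⟩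
        ∑[ j ≤ m ] (drops s (- 1#) j * ind (σ ⟨$⟩ʳ i) (μ j) * ½)
          ≈⟨ *-distribʳ-sum ½ (λ j → drops s (- 1#) j * ind (σ ⟨$⟩ʳ i) (μ j)) ⟨
        ∑[ j ≤ m ] (drops s (- 1#) j * ind (σ ⟨$⟩ʳ i) (μ j)) * ½
          ≈⟨ *-congʳ (∑drops*ind-μ s (- 1#) (σ ⟨$⟩ʳ i)) ⟩
        (b (σ ⟨$⟩ˡ (σ ⟨$⟩ʳ i)) - (- 1#)) * ½
          ≈⟨ *-congʳ (trans (+-congʳ (reflexive (≡.cong b (Perm.inverseˡ σ))))
               (solve 1 (λ b → b :- (:- :1) := b :+ :1) refl (b i))) ⟩
        β b i ∎

    -- The affine majorant d agrees with pos (affine p a) on the support of q,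
    -- and all of P b assigns to it the same expectation.
    ≤-supervertex : ∀ p {a} → (∀ i → 0# ≤ a i) → ∀ {x} → x ∈ P b →
                    ⟨ (λ l → pos (affine p a l)) , x ⟩ ≤ ⟨ (λ l → pos (affine p a l)) , q ⟩
    ≤-supervertex p {a} 0≤a {x} x∈P =
      ≤-respʳ-≈ same-expectation (⟨⟩-monoˡ-≤ x (proj₁ x∈P) majorant)
      where
      aσ d : Vector Carrier m
      aσ = a ∘⁻¹ σ
      d = increments p aσ

      sorted : ∀ l → affine p a l ≈ affine p aσ (l ∘𝓛 (σ ⟨$⟩ˡ_))
      sorted l = sym (trans (affine-permute σ p aσ l)
        (affine-cong l refl (λ i → reflexive (≡.cong a (Perm.inverseˡ σ)))))

      majorant : ∀ l → pos (affine p a l) ≤ affine (pos p) (d ∘ (σ ⟨$⟩ʳ_)) l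
      majorant l = ≤-respˡ-≈ (pos-cong (sym (sorted l))) (≤-respʳ-≈ (affine-permute σ (pos p) d l)
        (pos-affine-≤ ≤-refl (λ i → 0≤a (σ ⟨$⟩ˡ i)) (l ∘𝓛 (σ ⟨$⟩ˡ_))))

      tight : ∀ j → affine (pos p) (d ∘ (σ ⟨$⟩ʳ_)) (κ j) ≈ pos (affine p a (κ j))
      tight j = begin
        affine (pos p) (d ∘ (σ ⟨$⟩ʳ_)) (κ j)        ≈⟨ affine-permute σ (pos p) d (κ j) ⟨
        affine (pos p) d (κ j ∘𝓛 (σ ⟨$⟩ˡ_))         ≡⟨ ≡.cong (affine (pos p) d) κ≡μ ⟩
        affine (pos p) d (μ j)                      ≈⟨ pos-affine-μ p aσ j ⟨
        pos (affine p aσ (μ j))                     ≡⟨ ≡.cong (pos ∘ affine p aσ) κ≡μ ⟨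
        pos (affine p aσ (κ j ∘𝓛 (σ ⟨$⟩ˡ_)))        ≈⟨ pos-cong (sorted (κ j)) ⟨
        pos (affine p a (κ j))                      ∎
        where
        κ≡μ : κ j ∘𝓛 (σ ⟨$⟩ˡ_) ≡ μ j
        κ≡μ = ∘𝓛-cancel (μ j) (λ _ → Perm.inverseʳ σ)

      same-expectation : ⟨ affine (pos p) (d ∘ (σ ⟨$⟩ʳ_)) , x ⟩ ≈ ⟨ (λ l → pos (affine p a l)) , q ⟩
      same-expectation = begin
        ⟨ affine (pos p) (d ∘ (σ ⟨$⟩ʳ_)) , x ⟩
          ≈⟨ ⟨affine,x⟩ b x∈P (pos p) (d ∘ (σ ⟨$⟩ʳ_)) ⟩
        pos p + ∑[ i < m ] (d (σ ⟨$⟩ʳ i) * β b i)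
          ≈⟨ ⟨affine,x⟩ b supervertex∈P (pos p) (d ∘ (σ ⟨$⟩ʳ_)) ⟨
        ⟨ affine (pos p) (d ∘ (σ ⟨$⟩ʳ_)) , q ⟩
          ≈⟨ ⟨f,q⟩ (affine (pos p) (d ∘ (σ ⟨$⟩ʳ_))) ⟩
        ∑[ j ≤ m ] (w j * affine (pos p) (d ∘ (σ ⟨$⟩ʳ_)) (κ j))
          ≈⟨ sum-cong-≋ (λ j → *-congˡ {w j} (tight j)) ⟩
        ∑[ j ≤ m ] (w j * pos (affine p a (κ j)))
          ≈⟨ ⟨f,q⟩ (λ l → pos (affine p a l)) ⟨
        ⟨ (λ l → pos (affine p a l)) , q ⟩ ∎

  -- Sums of truncations

  Uℓ-pos⁺⇒affine : ∀ {m} {u : ℝ^𝓛 m} → u ∈ Uℓ-pos⁺ →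
    ∃[ k ] Σ[ p ∈ Vector Carrier k ] Σ[ a ∈ (Fin k → Vector Carrier m) ]
      (∀ j i → 0# ≤ a j i) × (∀ l → u l ≈ ∑[ j < k ] pos (affine (p j) (a j) l))
  Uℓ-pos⁺⇒affine {m} {u} (k , us , us∈ , u≈) = k , p , a , 0≤a , λ l →
    trans (u≈ l) (sum-cong-≋ (λ j → pos-cong (us≈ j l)))
    where
    p : Vector Carrier k
    p j = proj₁ (Uℓ-pos⇒affine (us∈ j))
    a : Fin k → Vector Carrier m
    a j = proj₁ (proj₂ (Uℓ-pos⇒affine (us∈ j)))
    0≤a : ∀ j i → 0# ≤ a j i
    0≤a j = proj₁ (proj₂ (proj₂ (Uℓ-pos⇒affine (us∈ j))))
    us≈ : ∀ j l → us j l ≈ affine (p j) (a j) l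
    us≈ j = proj₂ (proj₂ (proj₂ (Uℓ-pos⇒affine (us∈ j))))

  module _ {m} (b : Vector Carrier m) (cube : InUnitCube b) (q : ℝ^𝓛 m) (super : IsSupervertex b q)
           {u : ℝ^𝓛 m} (u∈ : u ∈ Uℓ-pos⁺) where
    private
      k : ℕ
      k = proj₁ (Uℓ-pos⁺⇒affine u∈)

      p : Vector Carrier k
      p = proj₁ (proj₂ (Uℓ-pos⁺⇒affine u∈))

      a : Fin k → Vector Carrier m
      a = proj₁ (proj₂ (proj₂ (Uℓ-pos⁺⇒affine u∈)))

      0≤a : ∀ j i → 0# ≤ a j i
      0≤a = proj₁ (proj₂ (proj₂ (proj₂ (Uℓ-pos⁺⇒affine u∈))))

      f : Fin k → ℝ^𝓛 m
      f j l = pos (affine (p j) (a j) l)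

      u≈∑f : ∀ l → u l ≈ ∑[ j < k ] f j l
      u≈∑f = proj₂ (proj₂ (proj₂ (proj₂ (Uℓ-pos⁺⇒affine u∈))))

      ⟨u,x⟩ : ∀ x → ⟨ u , x ⟩ ≈ ∑[ j < k ] ⟨ f j , x ⟩
      ⟨u,x⟩ x = trans (⟨⟩-congˡ x u≈∑f) (⟨⟩-sumˡ f x)

      0≤u : ∀ l → 0# ≤ u l
      0≤u l = ≤-respʳ-≈ (sym (u≈∑f l)) (sum-nonNegative (λ j → 0≤pos (affine (p j) (a j) l)))

      q∈P : q ∈ P b
      q∈P = supervertex∈P b cube super

      ⟨u,subvertex⟩≤ : ∀ {x} → x ∈ P b → ⟨ u , subvertex b ⟩ ≤ ⟨ u , x ⟩
      ⟨u,subvertex⟩≤ {x} x∈P = ≤-respˡ-≈ (sym (⟨u,x⟩ (subvertex b))) (≤-respʳ-≈ (sym (⟨u,x⟩ x))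
        (sum-mono-≤ (λ j → subvertex-≤ b cube (p j) (0≤a j) x∈P)))

      ≤⟨u,q⟩ : ∀ {x} → x ∈ P b → ⟨ u , x ⟩ ≤ ⟨ u , q ⟩
      ≤⟨u,q⟩ {x} x∈P = ≤-respˡ-≈ (sym (⟨u,x⟩ x)) (≤-respʳ-≈ (sym (⟨u,x⟩ q))
        (sum-mono-≤ (λ j → ≤-supervertex b cube super (p j) (0≤a j) x∈P)))

    0≤⟨u,subvertex⟩ : 0# ≤ ⟨ u , subvertex b ⟩
    0≤⟨u,subvertex⟩ = ≤-respʳ-≈ (sym (⟨u,x⟩ (subvertex b)))
      (sum-nonNegative (λ j → subvertex-nonNegative b cube (p j) (0≤a j)))

    supervertex-maximum : IsMaximum (E-values b u) (E q u)
    supervertex-maximum = (q , q∈P , refl) , λ { w (x , x∈P , w≈) → ≤-respˡ-≈ (sym w≈) (≤⟨u,q⟩ x∈P) }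

    subvertex-minimum : ∃[ v ] IsMinimum (E-values b u) v
      × ⟨ u , subvertex b ⟩ ≤ v
      × (sum b ≤ 2# - fromNat m →
         subvertex b ∈ P b × v ≈ ⟨ u , subvertex b ⟩ × ⟨ u , subvertex b ⟩ ≈ E (subvertex b) u)
    subvertex-minimum =
      let v , (x , x∈P , v≈) , least = minimum-exists b 0≤u q∈P
          sub≤v = ≤-respʳ-≈ (sym v≈) (⟨u,subvertex⟩≤ x∈P)
      in v , ((x , x∈P , v≈) , least) , sub≤v , λ ∑b≤2-m →
         let sub∈P = subvertex∈P b cube ∑b≤2-m
         -- Once in `P b`, the subvertex is itself a competitor for the minimum, which bounds `v`
         -- from above.
         in sub∈P , ≤-antisym (least _ (subvertex b , sub∈P , refl)) sub≤v , refl

theorem1p9 : ∀ {c ℓ₁ ℓ₂} (ℝ : Reals c ℓ₁ ℓ₂) →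
    let open Reals ℝ
        open Densities ℝ
    in
    (m : ℕ) → 1 ≤ℕ m →
    (b : Vector Carrier m) → InUnitCube b →
    (q* : ℝ^𝓛 m) → IsSupervertex b q* →
    (u : ℝ^𝓛 m) → u ∈ Uℓ-pos⁺ →
    0# ≤ ⟨ u , subvertex b ⟩
    × (q* ∈ P b × IsMaximum (E-values b u) (E q* u) × E q* u ≈ ⟨ u , q* ⟩)
    × (∃[ v ] IsMinimum (E-values b u) v
            × ⟨ u , subvertex b ⟩ ≤ v
            × (sum b ≤ 2# - fromNat m →
               subvertex b ∈ P b × v ≈ ⟨ u , subvertex b ⟩ × ⟨ u , subvertex b ⟩ ≈ E (subvertex b) u))
theorem1p9 ℝ m _ b cube q* super u u∈ =
    0≤⟨u,subvertex⟩ ℝ b cube q* super u∈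
  , (supervertex∈P ℝ b cube {q*} super , supervertex-maximum ℝ b cube q* super u∈ , Reals.refl ℝ)
  , subvertex-minimum ℝ b cube q* super u∈
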